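{- For $0\le r_1,r_2\le n$, $0\le s\le N(r_1,r_2)$ and $t\in\mathbb C$: $$\lambda_s^{r_1,r_2}(t,n)=\sum_{j=0}^s(-1)^j\binom{t}{j}\frac{[s]_j\,[n-s+1]_j}{[n-r_1]_j\,[r_2]_j};$$ if $s\ge1$, then $$\Delta\lambda_s^{r_1,r_2}(t,n)=-\frac{s(n-s+1)}{r_2(n-r_1)}\,\lambda_{s-1}^{r_1-1,r_2-1}(t,n-2);$$ and the leading coefficient (of $t^s$) of $\lambda_s^{r_1,r_2}(t,n)$ is $$a_s^{r_1,r_2}(n)=(-1)^s\frac{[n-s+1]_s}{[n-r_1]_s\,[r_2]_s}.$$
   Context: For a finite set $\Omega$ with $|\Omega|=n\ge1$, let $G=S(\Omega)$, $X=\mathcal P(\Omega)$, $X_r=\{x\in X:|x|=r\}$, with $G$ acting on $L^2(X)$ (complex functions on $X$; $L^2(X_r)$ = functions supported on $X_r$) by $(\rho(g)\psi)(x)=\psi(g^{ -1}x)$. For $0\le s\le\min(r,n-r)$, $L^2(X_r)_s$ is the unique irreducible $G$-subspace of $L^2(X_r)$ isomorphic to the irreducible representation associated with the partition $(n-s,s)$. $N(r_1,r_2)=\min(r_1,n-r_1,r_2,n-r_2)$. For $0\le s\le N(r_1,r_2)$, $\Lambda_s^{r_1,r_2}$ is a $G$-equivariant map $L^2(X)\to L^2(X)$ sending $L^2(X_{r_1})_s$ into $L^2(X_{r_2})_s$ and vanishing on its orthogonal complement, with kernel $\lambda$ defined on integers $\max(0,r_2-r_1)\le k\le\min(n-r_1,r_2)$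 by $(\Lambda_s^{r_1,r_2}\psi)(x_2)=\sum_{x_1\in X_{r_1}}\lambda(|x_2\setminus x_1|)\psi(x_1)$. The kernel agrees on its domain with a unique polynomial of degree $s$ which is nonzero at $0$; $\Lambda_s^{r_1,r_2}$ is normalized so that this polynomial takes the value $1$ at $t=0$, and this polynomial is denoted $\lambda_s^{r_1,r_2}(t,n)$; the same construction with a set of $n-2$ elements gives $\lambda_{s'}^{r_1',r_2'}(t,n-2)$. $\Delta h(t)=h(t+1)-h(t)$; $\binom{t}{j}=[t]_j/j!$; $[\alpha]_k=\alpha(\alpha-1)\cdots(\alpha-k+1)$. -}

module Defs where

open import Level using (0ℓ)
open import Algebra.Bundles using (RawRing)
open import Algebra.Apartness.Bundles using (HeytingField)
import Algebra.Definitions.RawSemiring as RawSemiringDefs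
open import Data.Bool.Base using (if_then_else_)
import Data.Bool.Properties as Bool
open import Data.Fin.Base using (Fin; inject≤)
open import Data.Fin.Permutation using (Permutation′; _⟨$⟩ˡ_; flip)
open import Data.Fin.Subset using (Subset; inside; outside; ⁅_⁆; ⋃; _─_; ∣_∣)
open import Data.List.Base as List using (List; []; _∷_; _++_; filter; foldr)
open import Data.Nat.Base as ℕ using (ℕ; zero; suc; _≤_; _∸_; _⊓_; _!)
import Data.Nat.Properties as ℕ
open import Data.Product.Base using (Σ; ∃; _×_; _,_; proj₁; proj₂)
open import Data.Sum.Base using (_⊎_; inj₁; inj₂)
open import Data.Vec.Base as Vec using (lookup; tabulate)
import Data.Vec.Properties as Vec
open import Function.Bundles using (_↔_; Inverse)
open import Relation.Binary.Core using (Rel)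
open import Relation.Binary.PropositionalEquality using (_≡_; _≢_)
open import Relation.Binary.Structures using (IsStrictPartialOrder)
open import Relation.Nullary.Decidable.Core using (does)

-- The real numbers, characterised axiomatically as a Cauchy-complete
-- Archimedean ordered field.  Equality is a setoid equality and is not assumed
-- decidable; apartness plays the role of "≠", so that the axioms hold
-- constructively (for the Cauchy reals) as well as classically.

record RealNumbers : Set₁ where
  infix 4 _<_
  field
    heytingField : HeytingField 0ℓ 0ℓ 0ℓ

  open HeytingField heytingField public

  field
    _<_                  : Rel Carrier 0ℓ
    isStrictPartialOrder : IsStrictPartialOrder _≈_ _<_
    #⇒<⊎>                : ∀ {x y} → x # y → x < y ⊎ y < x
    <⇒#                  : ∀ {x y} → x < y → x # y
    0<1                  : 0# < 1#
    +-monoʳ-<            : ∀ z {x y} → x < y → z + x < z + y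
    *-pos                : ∀ {x y} → 0# < x → 0# < y → 0# < x * y

  private
    rawRing : RawRing 0ℓ 0ℓ
    rawRing = record
      { Carrier = Carrier ; _≈_ = _≈_ ; _+_ = _+_ ; _*_ = _*_
      ; -_ = -_ ; 0# = 0# ; 1# = 1# }

  open RawSemiringDefs (RawRing.rawSemiring rawRing)
    using () renaming (_×_ to _times_)

  fromℕ : ℕ → Carrier
  fromℕ m = m times 1#

  _within_of_ : Carrier → Carrier → Carrier → Set
  x within ε of y = (x < y + ε) × (y < x + ε)

  field
    archimedean : ∀ x → ∃ λ m → x < fromℕ m
    complete    : (a : ℕ → Carrier) →
                  (∀ ε → 0# < ε → ∃ λ M → ∀ i j → M ≤ i → M ≤ j →
                    a i within ε of a j) →
                  ∃ λ L → ∀ ε → 0# < ε → ∃ λ M → ∀ i → M ≤ i →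
                    a i within ε of L

  private
    open IsStrictPartialOrder isStrictPartialOrder using ()
      renaming (trans to <-trans; <-respʳ-≈ to <-respʳ; <-respˡ-≈ to <-respˡ)

    0<fromℕ : ∀ m → 0# < fromℕ (suc m)
    0<fromℕ zero    = <-respʳ (sym (+-identityʳ 1#)) 0<1
    0<fromℕ (suc m) =
      <-trans 0<1
        (<-respˡ (+-identityʳ 1#) (+-monoʳ-< 1# (0<fromℕ m)))

  1/suc : ℕ → Carrier
  1/suc m = proj₁ (#⇒invertible (#-sym (<⇒# (0<fromℕ m))))

module Complex (R : RealNumbers) where

  private module ℝ = RealNumbers R

  infix  4 _≈_ _#_
  infixl 6 _+_ _-_
  infixl 7 _*_ _/_
  infix  8 -_

  record ℂ : Set where
    constructor _+i_
    field
      re im : ℝ.Carrier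

  open ℂ public

  _≈_ _#_ : Rel ℂ 0ℓ
  z ≈ w = (re z ℝ.≈ re w) × (im z ℝ.≈ im w)
  z # w = (re z ℝ.# re w) ⊎ (im z ℝ.# im w)

  _+_ _*_ : ℂ → ℂ → ℂ
  -_ conj : ℂ → ℂ
  0# 1#   : ℂ
  z + w  = (re z ℝ.+ re w) +i (im z ℝ.+ im w)
  z * w  = (re z ℝ.* re w ℝ.- im z ℝ.* im w) +i (re z ℝ.* im w ℝ.+ im z ℝ.* re w)
  - z    = (ℝ.- re z) +i (ℝ.- im z)
  conj z = re z +i (ℝ.- im z)
  0#     = ℝ.0# +i ℝ.0#
  1#     = ℝ.1# +i ℝ.0#

  _-_ : ℂ → ℂ → ℂ
  z - w = z + (- w)

  rawRing : RawRing 0ℓ 0ℓ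
  rawRing = record
    { Carrier = ℂ ; _≈_ = _≈_ ; _+_ = _+_ ; _*_ = _*_ ; -_ = -_ ; 0# = 0# ; 1# = 1# }

  -- `sum f` adds up a finite family f : Fin m → ℂ.
  open RawSemiringDefs (RawRing.rawSemiring rawRing) public
    using (_^_; sum) renaming (_×_ to _times_)

  fromℕ : ℕ → ℂ
  fromℕ m = m times 1#

  -- Division by a natural number, with the convention z / 0 = 0.
  _/_ : ℂ → ℕ → ℂ
  z / zero    = 0#
  z / (suc m) = z * (ℝ.1/suc m +i ℝ.0#)

  ∑ : ∀ {A : Set} → List A → (A → ℂ) → ℂ
  ∑ xs f = foldr (λ x acc → f x + acc) 0# xs

  -- [α]ₖ = α (α − 1) ⋯ (α − k + 1).  For natural α this is `α P k`.
  falling : ℂ → ℕ → ℂ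
  falling α zero    = 1#
  falling α (suc k) = falling α k * (α - fromℕ k)

  binom : ℂ → ℕ → ℂ
  binom t j = falling t j / (j !)

  Δ : (ℂ → ℂ) → (ℂ → ℂ)
  Δ h t = h (t + 1#) - h t

  -- Polynomials over ℂ: lists of coefficients, constant term first; trailing
  -- zeros are allowed.
  Poly : Set
  Poly = List ℂ

  eval : Poly → ℂ → ℂ
  eval []      t = 0#
  eval (c ∷ p) t = c + t * eval p t

  coeff : Poly → ℕ → ℂ
  coeff []      k       = 0#
  coeff (c ∷ p) zero    = c
  coeff (c ∷ p) (suc k) = coeff p k

  HasDegree : Poly → ℕ → Set
  HasDegree p d = (coeff p d # 0#) × (∀ k → d ℕ.< k → coeff p k ≈ 0#)

-- Ω = Fin n, X = Subset n, G = Permutation′ n.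

subsets : ∀ n → List (Subset n)
subsets zero    = Vec.[] ∷ []
subsets (suc n) =
  List.map (outside Vec.∷_) (subsets n) ++ List.map (inside Vec.∷_) (subsets n)

subsetsOfSize : ∀ n → ℕ → List (Subset n)
subsetsOfSize n r = filter (λ x → ∣ x ∣ ℕ.≟ r) (subsets n)

-- The image g x = { g i ∣ i ∈ x }: i belongs to it iff g⁻¹ i belongs to x.
_•_ : ∀ {n} → Permutation′ n → Subset n → Subset n
g • x = tabulate (λ i → lookup x (g ⟨$⟩ˡ i))

N : ℕ → ℕ → ℕ → ℕ
N n r₁ r₂ = r₁ ⊓ (n ∸ r₁) ⊓ r₂ ⊓ (n ∸ r₂)

-- A Young tableau of shape (n − s , s): the cells inj₁ j and inj₂ j are the j-th
-- cells of the first and of the second row, filled bijectively from Fin n.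
record Tableau (n s : ℕ) : Set where
  field
    isPartition : s ≤ n ∸ s
    entry       : (Fin (n ∸ s) ⊎ Fin s) ↔ Fin n

  top bottom : Fin s → Fin n
  top    j = Inverse.to entry (inj₁ (inject≤ j isPartition))
  bottom j = Inverse.to entry (inj₂ j)

  -- The column stabiliser is the group of order 2ˢ whose element indexed by
  -- e ⊆ Fin s exchanges the two entries of column j for every j ∈ e; its sign is
  -- (−1)^∣e∣.  This is the second row after applying that element.  A tabloid of
  -- shape (n − s , s) is determined by its second row, so the tabloids are
  -- identified with the s-element subsets of Fin n.
  secondRow : Subset s → Subset n
  secondRow e =
    ⋃ (List.map (λ j → ⁅ if lookup e j then top j else bottom j ⁆) (List.allFin s))

module Representation (R : RealNumbers) where

  open Complex R public

  infix 4 _⊆_ _≅_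

  L² : ℕ → Set
  L² n = Subset n → ℂ

  module _ {n : ℕ} where

    infix  4 _≋_
    infixl 6 _⊕_
    infixr 7 _⊙_

    _≋_ : L² n → L² n → Set
    φ ≋ ψ = ∀ x → φ x ≈ ψ x

    𝟘 : L² n
    𝟘 x = 0#

    _⊕_ : L² n → L² n → L² n
    (φ ⊕ ψ) x = φ x + ψ x

    _⊙_ : ℂ → L² n → L² n
    (c ⊙ ψ) x = c * ψ x

    ρ : Permutation′ n → L² n → L² n
    ρ g ψ x = ψ (flip g • x)

    ⟨_,_⟩ : L² n → L² n → ℂ
    ⟨ φ , ψ ⟩ = ∑ (subsets n) (λ x → φ x * conj (ψ x))

    NonZeroFn : L² n → Set
    NonZeroFn ψ = ∃ λ x → ψ x # 0#

    SupportedOnSize : ℕ → L² n → Set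
    SupportedOnSize r ψ = ∀ x → ∣ x ∣ ≢ r → ψ x ≈ 0#

    δ : Subset n → L² n
    δ x y = if does (Vec.≡-dec Bool._≟_ y x) then 1# else 0#

  record GSubspace (n : ℕ) : Set₁ where
    field
      Mem      : L² n → Set
      ≋-closed : ∀ {φ ψ} → φ ≋ ψ → Mem φ → Mem ψ
      𝟘-closed : Mem 𝟘
      ⊕-closed : ∀ {φ ψ} → Mem φ → Mem ψ → Mem (φ ⊕ ψ)
      ⊙-closed : ∀ c {ψ} → Mem ψ → Mem (c ⊙ ψ)
      ρ-closed : ∀ g {ψ} → Mem ψ → Mem (ρ g ψ)

    Elt : Set
    Elt = Σ (L² n) Mem

  open GSubspace public

  data Generated {n : ℕ} (S : L² n → Set) : L² n → Set where
    gen  : ∀ {ψ} → S ψ → Generated S ψ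
    resp : ∀ {φ ψ} → φ ≋ ψ → Generated S φ → Generated S ψ
    zer  : Generated S 𝟘
    add  : ∀ {φ ψ} → Generated S φ → Generated S ψ → Generated S (φ ⊕ ψ)
    scal : ∀ c {ψ} → Generated S ψ → Generated S (c ⊙ ψ)
    act  : ∀ g {ψ} → Generated S ψ → Generated S (ρ g ψ)

  generated : ∀ {n} → (L² n → Set) → GSubspace n
  generated S = record
    { Mem = Generated S ; ≋-closed = resp ; 𝟘-closed = zer
    ; ⊕-closed = add ; ⊙-closed = scal ; ρ-closed = act }

  _⊆_ : ∀ {n} → GSubspace n → GSubspace n → Set
  V ⊆ W = ∀ ψ → Mem V ψ → Mem W ψ

  -- "Every nonzero G-subspace W of V is all of V", with "nonzero" read
  -- positively (some value is apart from 0).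
  record IsIrreducible {n : ℕ} (V : GSubspace n) : Set₁ where
    field
      nonzero : ∃ λ ψ → Mem V ψ × NonZeroFn ψ
      minimal : (W : GSubspace n) → W ⊆ V →
                (∃ λ ψ → Mem W ψ × NonZeroFn ψ) → V ⊆ W

  record _≅_ {n : ℕ} (V W : GSubspace n) : Set where
    field
      to         : Elt V → Elt W
      cong       : ∀ u v → proj₁ u ≋ proj₁ v → proj₁ (to u) ≋ proj₁ (to v)
      additive   : ∀ u v → proj₁ (to (_ , ⊕-closed V (proj₂ u) (proj₂ v)))
                           ≋ proj₁ (to u) ⊕ proj₁ (to v)
      homogen    : ∀ c u → proj₁ (to (_ , ⊙-closed V c (proj₂ u)))
                           ≋ c ⊙ proj₁ (to u)
      equivar    : ∀ g u → proj₁ (to (_ , ρ-closed V g (proj₂ u)))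
                           ≋ ρ g (proj₁ (to u))
      injective  : ∀ u v → proj₁ (to u) ≋ proj₁ (to v) → proj₁ u ≋ proj₁ v
      surjective : ∀ (w : Elt W) → ∃ λ u → proj₁ (to u) ≋ proj₁ w

  -- The signed sum of the tabloids σT over the column stabiliser of T.
  polytabloid : ∀ {n s} → Tableau n s → L² n
  polytabloid {n} {s} T x =
    ∑ (subsets s) (λ e → (- 1#) ^ ∣ e ∣ * δ (Tableau.secondRow T e) x)

  -- The Specht module of (n − s , s), the irreducible representation of the
  -- symmetric group associated with that partition.
  Specht : ∀ n s → GSubspace n
  Specht n s = generated (λ ψ → ∃ λ (T : Tableau n s) → ψ ≋ polytabloid T)

  -- V is L²(X_r)_s.
  record IsComponent (n r s : ℕ) (V : GSubspace n) : Set₁ where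
    field
      supported   : ∀ ψ → Mem V ψ → SupportedOnSize r ψ
      irreducible : IsIrreducible V
      isSpecht    : V ≅ Specht n s

  -- Λ is a G-equivariant linear map sending L²(X_{r₁})_s = V₁ into
  -- L²(X_{r₂})_s = V₂, zero on the orthogonal complement of V₁ in L²(X), with
  -- kernel κ.  Only the values κ k with max(0, r₂ − r₁) ≤ k ≤ min(n − r₁, r₂)
  -- occur as ∣ x₂ ─ x₁ ∣, so the values of κ elsewhere are irrelevant.
  record IsIntertwinerWithKernel (n r₁ r₂ : ℕ) (V₁ V₂ : GSubspace n)
                                 (Λ : L² n → L² n) (κ : ℕ → ℂ) : Set where
    field
      cong        : ∀ {φ ψ} → φ ≋ ψ → Λ φ ≋ Λ ψ
      additive    : ∀ φ ψ → Λ (φ ⊕ ψ) ≋ Λ φ ⊕ Λ ψ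
      homogen     : ∀ c ψ → Λ (c ⊙ ψ) ≋ c ⊙ Λ ψ
      equivar     : ∀ g ψ → Λ (ρ g ψ) ≋ ρ g (Λ ψ)
      maps-into   : ∀ ψ → Mem V₁ ψ → Mem V₂ (Λ ψ)
      vanishes    : ∀ ψ → (∀ φ → Mem V₁ φ → ⟨ ψ , φ ⟩ ≈ 0#) → Λ ψ ≋ 𝟘
      kernel      : ∀ ψ x₂ → ∣ x₂ ∣ ≡ r₂ →
                    Λ ψ x₂ ≈ ∑ (subsetsOfSize n r₁) (λ x₁ → κ ∣ x₂ ─ x₁ ∣ * ψ x₁)

  -- p is the polynomial λ_s^{r₁,r₂}(t , n).
  record Isλ (n r₁ r₂ s : ℕ) (p : Poly) : Set₁ where
    field
      V₁ V₂       : GSubspace n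
      component₁  : IsComponent n r₁ s V₁
      component₂  : IsComponent n r₂ s V₂
      Λ           : L² n → L² n
      κ           : ℕ → ℂ
      intertwiner : IsIntertwinerWithKernel n r₁ r₂ V₁ V₂ Λ κ
      degree      : HasDegree p s
      agrees      : ∀ k → r₂ ∸ r₁ ≤ k → k ≤ (n ∸ r₁) ⊓ r₂ → eval p (fromℕ k) ≈ κ k
      normalised  : eval p 0# ≈ 1#

{-# OPTIONS --safe #-}

-- The sum of all transpositions acts on the representation (n − s , s) by a
-- scalar: the polytabloids are harmonic, i.e. summing such a ψ over all z ∪ {j}
-- with j ∉ z gives 0, and on harmonic functions of degree s the operator
-- ψ ↦ Σ_{i ∈ x, j ∉ x} (ψ(x − i + j) − ψ(x)) is −s(n − s + 1).  An isomorphism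
-- carries this to L²(X_{r₁})_s.  As Λ kills the orthogonal complement of that
-- space, its kernel satisfies the same eigenvalue equation, which after counting
-- the four kinds of moves is the Hahn difference equation
--   (r₂ − t)(n − r₁ − t)(λ(t+1) − λ(t)) + t(r₁ − r₂ + t)(λ(t−1) − λ(t)) + s(n − s + 1)λ(t) = 0
-- at the integers of the domain of the kernel.  In the basis of falling
-- factorials [t]_j the left side has degree < s, hence vanishes identically, and
-- this is a two-term recurrence for the coefficients of λ.

module Submission where

open import Algebra.Bundles using (CommutativeRing)
import Algebra.Properties.CommutativeMonoid.Sum as CommutativeMonoidSum
import Algebra.Properties.Ring as RingProperties
import Algebra.Properties.Semiring.Mult.TCOptimised as SemiringMult
import Algebra.Properties.Semiring.Sum as SemiringSum
import Algebra.Solver.Ring as RingSolver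
open import Algebra.Solver.Ring.AlmostCommutativeRing using (fromCommutativeRing; _-Raw-AlmostCommutative⟶_)
open import Data.Bool.Base using (Bool; true; false; not; if_then_else_; T)
import Data.Bool.Properties as Bool
open import Data.Fin.Base using (Fin; zero; suc; toℕ)
open import Data.Fin.Permutation using (Permutation′; _⟨$⟩ʳ_; _⟨$⟩ˡ_; flip; transpose; inverseˡ)
import Data.Fin.Properties as Fin
open import Data.Fin.Subset using (Subset; inside; outside; ⁅_⁆; ⋃; _∪_; _─_; ∣_∣; _∈_; _∉_)
import Data.Fin.Subset.Properties as Subset
open import Data.Integer.Base as ℤ using (ℤ; +_; -[1+_])
import Data.Integer.Properties as ℤ
open import Data.List.Base as List using (List; []; _∷_; _++_; filter; length)
open import Data.List.Membership.Propositional using () renaming (_∈_ to _∈ˡ_)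
open import Data.List.Membership.Propositional.Properties using (∈-allFin)
import Data.List.Properties as List
import Data.List.Relation.Unary.All as All
open import Data.List.Relation.Unary.AllPairs using ([]; _∷_)
open import Data.List.Relation.Unary.Any using (here; there)
open import Data.List.Relation.Unary.Unique.Propositional using (Unique)
open import Data.List.Relation.Unary.Unique.Propositional.Properties using (allFin⁺)
open import Data.Maybe.Base as Maybe using ()
open import Data.Nat.Base as ℕ using (ℕ; zero; suc; _≤_; _<_; _∸_; _⊓_; _!; NonZero; z≤n; s≤s; _≤ᵇ_)
open import Data.Nat.Combinatorics using (_P_; nPn≡n!)
import Data.Nat.Properties as ℕ
open import Data.Product.Base using (∃; ∃₂; _×_; _,_; proj₁; proj₂)
open import Data.Sum.Base using (inj₁; inj₂)
open import Data.Sum.Properties using (inj₁-injective; inj₂-injective)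
open import Data.Vec.Base as Vec using ([]; _∷_; lookup; _[_]≔_; updateAt)
open import Data.Vec.Properties
  using (≡-dec; ∷-injective; tabulate∘lookup; tabulate-cong; lookup∘tabulate; lookup∘update; lookup∘update′
        ; lookup∘updateAt; lookup∘updateAt′; []≔-idempotent; []≔-lookup; []≔-updates; lookup⇒[]=; []=⇒lookup)
open import Function.Base using (_∘_)
open import Function.Bundles using (Inverse)
open import Level using (0ℓ)
open import Relation.Binary.PropositionalEquality as ≡ using (_≡_; _≢_)
import Relation.Binary.Reasoning.Setoid as SetoidReasoning
open import Relation.Nullary.Decidable.Core using (yes; no; dec⇒maybe)
open import Relation.Nullary.Negation using (¬_; contradiction)
open import Relation.Unary using (Decidable)
open import Defs

-- Equality of complex numbers is not decidable here, so nothing may depend on testing whether a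
-- coefficient is zero. Hence the only divisors are nonzero natural numbers, closed forms are
-- compared after clearing them, and a polynomial is shown to vanish by repeated differencing at
-- consecutive integers instead of by splitting off roots. The loss of one degree in the Hahn
-- equation is what the value of the eigenvalue provides: the difference operator is bidiagonal on
-- falling factorials, its diagonal entry at [t]_j is s(n - s + 1) - j(n - j + 1), and this is 0 at
-- j = s. So s zeros suffice, while the domain of the kernel consists of N(r₁, r₂) + 1 > s
-- consecutive integers. The eigenvalue equation has to be extracted from what Λ kills. For this the
-- Laplacian is moved from the functions of the component to a point mass, which is possible because
-- it is symmetric and its eigenvalue is real.

-- Ring identities with integer coefficients.

module IntegerSolver (K : CommutativeRing 0ℓ 0ℓ) where

  open CommutativeRing K
  open RingProperties ring using (-‿involutive; -0#≈0#; -‿distribˡ-*; -‿+-comm)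
  open SemiringMult semiring using (×-homo-+; 1+×) renaming (_×_ to _·_)
  open SetoidReasoning setoid

  private
    -- With the optimised multiple, `1 · x` is `x` by definition, so the solver constants
    -- `con (+ 0)` and `con (+ 1)` unfold to `0#` and `1#` and match the goals as they stand.
    ⟦_⟧ : ℤ → Carrier
    ⟦ + n ⟧      = n · 1#
    ⟦ -[1+ n ] ⟧ = - (suc n · 1#)

    ⊖-homo : ∀ m n → ⟦ m ℤ.⊖ n ⟧ ≈ m · 1# - n · 1#
    ⊖-homo zero    zero    = sym (-‿inverseʳ 0#)
    ⊖-homo zero    (suc n) = sym (+-identityˡ _)
    ⊖-homo (suc m) zero    = sym (trans (+-congˡ -0#≈0#) (+-identityʳ _))
    ⊖-homo (suc m) (suc n) = begin
      ⟦ suc m ℤ.⊖ suc n ⟧                ≡⟨ ≡.cong ⟦_⟧ (ℤ.[1+m]⊖[1+n]≡m⊖n m n) ⟩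
      ⟦ m ℤ.⊖ n ⟧                        ≈⟨ ⊖-homo m n ⟩
      m · 1# - n · 1#                    ≈⟨ +-identityˡ _ ⟨
      0# + (m · 1# - n · 1#)             ≈⟨ +-congʳ (-‿inverseʳ 1#) ⟨
      (1# - 1#) + (m · 1# - n · 1#)      ≈⟨ +-assoc _ _ _ ⟩
      1# + (- 1# + (m · 1# - n · 1#))    ≈⟨ +-congˡ (+-assoc _ _ _) ⟨
      1# + ((- 1# + m · 1#) - n · 1#)    ≈⟨ +-congˡ (+-congʳ (+-comm _ _)) ⟩
      1# + ((m · 1# - 1#) - n · 1#)      ≈⟨ +-congˡ (+-assoc _ _ _) ⟩
      1# + (m · 1# + (- 1# - n · 1#))    ≈⟨ +-assoc _ _ _ ⟨
      (1# + m · 1#) + (- 1# - n · 1#)    ≈⟨ +-congˡ (-‿+-comm _ _) ⟩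
      (1# + m · 1#) - (1# + n · 1#)      ≈⟨ +-cong (1+× m 1#) (-‿cong (1+× n 1#)) ⟨
      suc m · 1# - suc n · 1#            ∎

    -‿homo : ∀ i → ⟦ ℤ.- i ⟧ ≈ - ⟦ i ⟧
    -‿homo (+ zero)  = sym -0#≈0#
    -‿homo (+ suc n) = refl
    -‿homo -[1+ n ]  = sym (-‿involutive _)

    +-homo : ∀ i j → ⟦ i ℤ.+ j ⟧ ≈ ⟦ i ⟧ + ⟦ j ⟧
    +-homo (+ m)    (+ n)    = ×-homo-+ 1# m n
    +-homo (+ m)    -[1+ n ] = ⊖-homo m (suc n)
    +-homo -[1+ m ] (+ n)    = trans (⊖-homo n (suc m)) (+-comm _ _)
    +-homo -[1+ m ] -[1+ n ] = begin
      - (suc (suc (m ℕ.+ n)) · 1#)    ≡⟨ ≡.cong (λ k → - (suc k · 1#)) (≡.sym (ℕ.+-suc m n)) ⟩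
      - ((suc m ℕ.+ suc n) · 1#)      ≈⟨ -‿cong (×-homo-+ 1# (suc m) (suc n)) ⟩
      - (suc m · 1# + suc n · 1#)     ≈⟨ -‿+-comm _ _ ⟨
      - (suc m · 1#) - suc n · 1#     ∎

    pos-*-homo : ∀ m j → ⟦ + m ℤ.* j ⟧ ≈ m · 1# * ⟦ j ⟧
    pos-*-homo zero    j = sym (zeroˡ _)
    pos-*-homo (suc m) j = begin
      ⟦ + suc m ℤ.* j ⟧                ≡⟨ ≡.cong ⟦_⟧ (ℤ.suc-* (+ m) j) ⟩
      ⟦ j ℤ.+ + m ℤ.* j ⟧              ≈⟨ +-homo j (+ m ℤ.* j) ⟩
      ⟦ j ⟧ + ⟦ + m ℤ.* j ⟧            ≈⟨ +-cong (sym (*-identityˡ _)) (pos-*-homo m j) ⟩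
      1# * ⟦ j ⟧ + m · 1# * ⟦ j ⟧      ≈⟨ distribʳ _ _ _ ⟨
      (1# + m · 1#) * ⟦ j ⟧            ≈⟨ *-congʳ (1+× m 1#) ⟨
      suc m · 1# * ⟦ j ⟧               ∎

    *-homo : ∀ i j → ⟦ i ℤ.* j ⟧ ≈ ⟦ i ⟧ * ⟦ j ⟧
    *-homo (+ m)    j = pos-*-homo m j
    *-homo -[1+ m ] j = begin
      ⟦ -[1+ m ] ℤ.* j ⟧            ≡⟨ ≡.cong ⟦_⟧ (≡.sym (ℤ.neg-distribˡ-* (+ suc m) j)) ⟩
      ⟦ ℤ.- (+ suc m ℤ.* j) ⟧       ≈⟨ -‿homo (+ suc m ℤ.* j) ⟩
      - ⟦ + suc m ℤ.* j ⟧           ≈⟨ -‿cong (pos-*-homo (suc m) j) ⟩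
      - (suc m · 1# * ⟦ j ⟧)        ≈⟨ -‿distribˡ-* _ _ ⟩
      - (suc m · 1#) * ⟦ j ⟧        ∎

    morphism : ℤ.+-*-rawRing -Raw-AlmostCommutative⟶ fromCommutativeRing K
    morphism = record
      { ⟦_⟧ = ⟦_⟧ ; +-homo = +-homo ; *-homo = *-homo ; -‿homo = -‿homo
      ; 0-homo = refl ; 1-homo = refl }

  open RingSolver ℤ.+-*-rawRing (fromCommutativeRing K) morphism
    (λ i j → Maybe.map (λ i≡j → reflexive (≡.cong ⟦_⟧ i≡j)) (dec⇒maybe (i ℤ.≟ j))) public
    using (solve; _:=_; _:+_; _:*_; _:-_; :-_; con)

-- The complex numbers as a commutative ring, and division by natural numbers.

module ComplexField (R : RealNumbers) where

  private module ℝ = RealNumbers R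

  ℝ-commutativeRing : CommutativeRing 0ℓ 0ℓ
  ℝ-commutativeRing = record { isCommutativeRing = ℝ.isCommutativeRing }

  open Complex R

  private
    module ℝS = IntegerSolver ℝ-commutativeRing

  -- z ≈ w unfolds to a pair of real equations, from which z and w cannot be
  -- inferred; the wrapper keeps them visible to unification.
  infix 4 _≃_
  record _≃_ (z w : ℂ) : Set where
    constructor mk≃
    field ≃⇒≈ : z ≈ w
  open _≃_ public

  ℂ-commutativeRing : CommutativeRing 0ℓ 0ℓ
  ℂ-commutativeRing = record
    { Carrier = ℂ ; _≈_ = _≃_ ; _+_ = _+_ ; _*_ = _*_ ; -_ = -_ ; 0# = 0# ; 1# = 1#
    ; isCommutativeRing = record
      { isRing = record
        { +-isAbelianGroup = record
          { isGroup = record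
            { isMonoid = record
              { isSemigroup = record
                { isMagma = record
                  { isEquivalence = record
                    { refl = mk≃ (ℝ.refl , ℝ.refl)
                    ; sym = λ (mk≃ (p , q)) → mk≃ (ℝ.sym p , ℝ.sym q)
                    ; trans = ≃-trans }
                  ; ∙-cong = +-cong }
                ; assoc = λ _ _ _ → mk≃ (ℝ.+-assoc _ _ _ , ℝ.+-assoc _ _ _) }
              ; identity = (λ _ → mk≃ (ℝ.+-identityˡ _ , ℝ.+-identityˡ _))
                         , (λ _ → mk≃ (ℝ.+-identityʳ _ , ℝ.+-identityʳ _)) }
            ; inverse = (λ _ → mk≃ (ℝ.-‿inverseˡ _ , ℝ.-‿inverseˡ _))
                      , (λ _ → mk≃ (ℝ.-‿inverseʳ _ , ℝ.-‿inverseʳ _))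
            ; ⁻¹-cong = λ (mk≃ (p , q)) → mk≃ (ℝ.-‿cong p , ℝ.-‿cong q) }
          ; comm = λ _ _ → mk≃ (ℝ.+-comm _ _ , ℝ.+-comm _ _) }
        ; *-cong = λ (mk≃ (p , q)) (mk≃ (p′ , q′)) → mk≃
            ( ℝ.+-cong (ℝ.*-cong p p′) (ℝ.-‿cong (ℝ.*-cong q q′))
            , ℝ.+-cong (ℝ.*-cong p q′) (ℝ.*-cong q p′))
        ; *-assoc = *-assoc
        ; *-identity = *-identityˡ
                     , λ z → ≃-trans (*-comm z 1#) (*-identityˡ z)
        ; distrib = distribˡ
                  , λ z w v → ≃-trans (*-comm (w + v) z)
                     (≃-trans (distribˡ z w v) (+-cong (*-comm z w) (*-comm z v))) }
      ; *-comm = *-comm } }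
    where
    open ℝS

    ≃-trans : ∀ {z w v} → z ≃ w → w ≃ v → z ≃ v
    ≃-trans (mk≃ (p , q)) (mk≃ (p′ , q′)) = mk≃ (ℝ.trans p p′ , ℝ.trans q q′)

    +-cong : ∀ {z w z′ w′} → z ≃ z′ → w ≃ w′ → z + w ≃ z′ + w′
    +-cong (mk≃ (p , q)) (mk≃ (p′ , q′)) = mk≃ (ℝ.+-cong p p′ , ℝ.+-cong q q′)

    *-comm : ∀ z w → z * w ≃ w * z
    *-comm (a +i b) (c +i d) = mk≃
      ( solve 4 (λ a b c d → a :* c :- b :* d := c :* a :- d :* b) ℝ.refl a b c d
      , solve 4 (λ a b c d → a :* d :+ b :* c := c :* b :+ d :* a) ℝ.refl a b c d)

    *-assoc : ∀ z w v → z * w * v ≃ z * (w * v)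
    *-assoc (a +i b) (c +i d) (e +i f) = mk≃
      ( solve 6 (λ a b c d e f →
          (a :* c :- b :* d) :* e :- (a :* d :+ b :* c) :* f :=
          a :* (c :* e :- d :* f) :- b :* (c :* f :+ d :* e))
          ℝ.refl a b c d e f
      , solve 6 (λ a b c d e f →
          (a :* c :- b :* d) :* f :+ (a :* d :+ b :* c) :* e :=
          a :* (c :* f :+ d :* e) :+ b :* (c :* e :- d :* f))
          ℝ.refl a b c d e f)

    *-identityˡ : ∀ z → 1# * z ≃ z
    *-identityˡ (a +i b) = mk≃
      ( solve 2 (λ a b → con (+ 1) :* a :- con (+ 0) :* b := a) ℝ.refl a b
      , solve 2 (λ a b → con (+ 1) :* b :+ con (+ 0) :* a := b) ℝ.refl a b)

    distribˡ : ∀ z w v → z * (w + v) ≃ z * w + z * v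
    distribˡ (a +i b) (c +i d) (e +i f) = mk≃
      ( solve 6 (λ a b c d e f →
          a :* (c :+ e) :- b :* (d :+ f) :=
          (a :* c :- b :* d) :+ (a :* e :- b :* f))
          ℝ.refl a b c d e f
      , solve 6 (λ a b c d e f →
          a :* (d :+ f) :+ b :* (c :+ e) :=
          (a :* d :+ b :* c) :+ (a :* f :+ b :* e))
          ℝ.refl a b c d e f)

  conj-cong : ∀ {z w} → z ≃ w → conj z ≃ conj w
  conj-cong (mk≃ (p , q)) = mk≃ (p , ℝ.-‿cong q)

  conj-+ : ∀ z w → conj (z + w) ≃ conj z + conj w
  conj-+ (a +i b) (c +i d) = mk≃ (ℝ.refl , solve 2 (λ b d → :- (b :+ d) := :- b :+ :- d) ℝ.refl b d)
    where open ℝS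

  conj-* : ∀ z w → conj (z * w) ≃ conj z * conj w
  conj-* (a +i b) (c +i d) = mk≃
    ( solve 4 (λ a b c d → a :* c :- b :* d := a :* c :- :- b :* :- d) ℝ.refl a b c d
    , solve 4 (λ a b c d → :- (a :* d :+ b :* c) := a :* :- d :+ :- b :* c) ℝ.refl a b c d)
    where open ℝS

  open CommutativeRing ℂ-commutativeRing public
    using (refl; sym; trans; reflexive; setoid; semiring; +-cong; +-congˡ; +-congʳ; +-assoc; +-comm
          ; +-identityˡ; +-identityʳ; *-cong; *-congˡ; *-congʳ; *-assoc; *-comm; *-identityˡ; *-identityʳ
          ; zeroˡ; zeroʳ; distribˡ; distribʳ; -‿cong; -‿inverseʳ)
  open IntegerSolver ℂ-commutativeRing public
  open SetoidReasoning setoid public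

  fromℕ-+ : ∀ m n → fromℕ (m ℕ.+ n) ≃ fromℕ m + fromℕ n
  fromℕ-+ zero    n = sym (+-identityˡ _)
  fromℕ-+ (suc m) n = trans (+-congˡ (fromℕ-+ m n)) (sym (+-assoc _ _ _))

  fromℕ-* : ∀ m n → fromℕ (m ℕ.* n) ≃ fromℕ m * fromℕ n
  fromℕ-* zero    n = sym (zeroˡ _)
  fromℕ-* (suc m) n = begin
    fromℕ (n ℕ.+ m ℕ.* n)              ≈⟨ fromℕ-+ n (m ℕ.* n) ⟩
    fromℕ n + fromℕ (m ℕ.* n)          ≈⟨ +-congˡ (fromℕ-* m n) ⟩
    fromℕ n + fromℕ m * fromℕ n        ≈⟨ solve 2 (λ a b → b :+ a :* b := (con (+ 1) :+ a) :* b) refl (fromℕ m) (fromℕ n) ⟩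
    (1# + fromℕ m) * fromℕ n           ∎

  fromℕ-∸ : ∀ {m n} → n ≤ m → fromℕ (m ∸ n) ≃ fromℕ m - fromℕ n
  fromℕ-∸ {m} {n} n≤m = begin
    fromℕ (m ∸ n)                       ≈⟨ solve 2 (λ a b → a := a :+ b :- b) refl _ _ ⟩
    fromℕ (m ∸ n) + fromℕ n - fromℕ n   ≈⟨ +-congʳ (fromℕ-+ (m ∸ n) n) ⟨
    fromℕ (m ∸ n ℕ.+ n) - fromℕ n       ≡⟨ ≡.cong (λ k → fromℕ k - fromℕ n) (ℕ.m∸n+n≡m n≤m) ⟩
    fromℕ m - fromℕ n                   ∎

  private
    fromℕ-real : ∀ m → fromℕ m ≃ ℝ.fromℕ m +i ℝ.0#
    fromℕ-real zero    = refl
    fromℕ-real (suc m) = trans (+-congˡ (fromℕ-real m)) (mk≃ (ℝ.refl , ℝ.+-identityˡ _))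

    apart-inverse : ∀ {x} (x#0 : x ℝ.# ℝ.0#) → proj₁ (ℝ.#⇒invertible x#0) ℝ.* x ℝ.≈ ℝ.1#
    apart-inverse x#0 = ℝ.trans
      -- `#⇒invertible` inverts the difference `x - 0#`, not `x` itself.
      (ℝ.*-congˡ (ℝS.solve 1 (λ x → x ℝS.:= x ℝS.:- ℝS.con (+ 0)) ℝ.refl _))
      (proj₁ (proj₂ (ℝ.#⇒invertible x#0)))

    inverse : ℕ → ℂ
    inverse m = ℝ.1/suc m +i ℝ.0#

    inverse-* : ∀ m → inverse m * fromℕ (suc m) ≃ 1#
    inverse-* m = trans (*-congˡ (fromℕ-real (suc m))) (mk≃
      ( ℝ.trans (ℝ.+-cong (apart-inverse _) (ℝ.-‿cong (ℝ.zeroˡ _)))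
          (ℝS.solve 1 (λ x → x ℝS.:- ℝS.con (+ 0) ℝS.:= x) ℝ.refl ℝ.1#)
      , ℝ.trans (ℝ.+-cong (ℝ.zeroʳ _) (ℝ.zeroˡ _)) (ℝ.+-identityˡ _)))

  /-* : ∀ z k .{{_ : NonZero k}} → z / k * fromℕ k ≃ z
  /-* z (suc m) = begin
    z * inverse m * fromℕ (suc m)     ≈⟨ *-assoc _ _ _ ⟩
    z * (inverse m * fromℕ (suc m))   ≈⟨ *-congˡ (inverse-* m) ⟩
    z * 1#                            ≈⟨ *-identityʳ z ⟩
    z                                 ∎

  -- All denominators of the theorem are natural numbers, so every quotient below is handled by
  -- multiplying it out with `/-*` and cancelling here.
  *-fromℕ-cancelʳ : ∀ k .{{_ : NonZero k}} {z w} → z * fromℕ k ≃ w * fromℕ k → z ≃ w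
  *-fromℕ-cancelʳ (suc m) {z} {w} eq = begin
    z                                 ≈⟨ lemma z ⟨
    z * fromℕ (suc m) * inverse m     ≈⟨ *-congʳ eq ⟩
    w * fromℕ (suc m) * inverse m     ≈⟨ lemma w ⟩
    w                                 ∎
    where
    lemma : ∀ v → v * fromℕ (suc m) * inverse m ≃ v
    lemma v = begin
      v * fromℕ (suc m) * inverse m     ≈⟨ *-assoc _ _ _ ⟩
      v * (fromℕ (suc m) * inverse m)   ≈⟨ *-congˡ (trans (*-comm _ _) (inverse-* m)) ⟩
      v * 1#                            ≈⟨ *-identityʳ v ⟩
      v                                 ∎

  *-fromℕ-≃0 : ∀ k .{{_ : NonZero k}} {z} → z * fromℕ k ≃ 0# → z ≃ 0#
  *-fromℕ-≃0 k eq = *-fromℕ-cancelʳ k (trans eq (sym (zeroˡ _)))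

-- Falling factorials, Newton expansions and the Hahn difference operator.

-- `_P_` guards its product by the Boolean test `k ≤ᵇ n`; for `k < n` both guards are true, and the
-- recursion of the product appears.
P-suc : ∀ {n k} → k < n → n P suc k ≡ (n ∸ k) ℕ.* (n P k)
P-suc {n} {k} k<n with suc k ≤ᵇ n in eq₁ | k ≤ᵇ n in eq₂
... | true  | true  = ≡.refl
... | false | _     = contradiction (≡.subst T eq₁ (ℕ.≤⇒≤ᵇ k<n)) λ ()
... | true  | false = contradiction (≡.subst T eq₂ (ℕ.≤⇒≤ᵇ (ℕ.<⇒≤ k<n))) λ ()

P≢0 : ∀ {n k} → k ≤ n → NonZero (n P k)
P≢0 {k = zero}  k≤n = _
P≢0 {n} {suc k} k<n = ≡.subst NonZero (≡.sym (P-suc k<n))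
  (ℕ.m*n≢0 (n ∸ k) (n P k) {{ℕ.>-nonZero (ℕ.m<n⇒0<n∸m k<n)}} {{P≢0 (ℕ.<⇒≤ k<n)}})

module Newton (R : RealNumbers) where

  open Complex R
  open ComplexField R

  fromℕ-P-suc : ∀ {n k} → k < n → fromℕ (n P suc k) ≃ (fromℕ n - fromℕ k) * fromℕ (n P k)
  fromℕ-P-suc {n} {k} k<n = begin
    fromℕ (n P suc k)                     ≡⟨ ≡.cong fromℕ (P-suc k<n) ⟩
    fromℕ ((n ∸ k) ℕ.* (n P k))           ≈⟨ fromℕ-* (n ∸ k) (n P k) ⟩
    fromℕ (n ∸ k) * fromℕ (n P k)         ≈⟨ *-congʳ (fromℕ-∸ (ℕ.<⇒≤ k<n)) ⟩
    (fromℕ n - fromℕ k) * fromℕ (n P k)   ∎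

  falling-cong : ∀ {t u} j → t ≃ u → falling t j ≃ falling u j
  falling-cong zero    t≃u = refl
  falling-cong (suc j) t≃u = *-cong (falling-cong j t≃u) (+-congʳ t≃u)

  falling-1+ : ∀ t j → falling (t + 1#) (suc j) ≃ (t + 1#) * falling t j
  falling-1+ t zero    = solve 1 (λ t → con (+ 1) :* (t :+ con (+ 1) :- con (+ 0)) := (t :+ con (+ 1)) :* con (+ 1)) refl t
  falling-1+ t (suc j) = trans (*-congʳ (falling-1+ t j))
    (solve 3 (λ t f j → (t :+ con (+ 1)) :* f :* (t :+ con (+ 1) :- (con (+ 1) :+ j)) :=
                        (t :+ con (+ 1)) :* (f :* (t :- j)))
      refl t (falling t j) (fromℕ j))

  -- The backward difference in the Hahn operator carries a factor `t`, and this is why it stays a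
  -- combination of falling factorials of `t`.
  falling-−1 : ∀ t j → t * falling (t - 1#) j ≃ falling t (suc j)
  falling-−1 t j = begin
    t * falling (t - 1#) j               ≈⟨ *-congʳ t−1+1 ⟨
    (t - 1# + 1#) * falling (t - 1#) j   ≈⟨ falling-1+ (t - 1#) j ⟨
    falling (t - 1# + 1#) (suc j)        ≈⟨ falling-cong (suc j) t−1+1 ⟩
    falling t (suc j)                    ∎
    where
    t−1+1 : t - 1# + 1# ≃ t
    t−1+1 = solve 1 (λ t → t :- con (+ 1) :+ con (+ 1) := t) refl t

  Δ-falling : ∀ t j → falling (t + 1#) (suc j) - falling t (suc j) ≃ fromℕ (suc j) * falling t j
  Δ-falling t j = trans (+-congʳ (falling-1+ t j))
    (solve 3 (λ t f j → (t :+ con (+ 1)) :* f :- f :* (t :- j) := (con (+ 1) :+ j) :* f)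
      refl t (falling t j) (fromℕ j))

  -- The basis is [t]_j and not the binomial [t]_j / j!, which keeps division out of the whole
  -- calculus.
  newton : (ℕ → ℂ) → ℕ → ℂ → ℂ
  newton a zero    t = 0#
  newton a (suc m) t = newton a m t + a m * falling t m

  newton-cong : ∀ {a b} m t → (∀ j → j < m → a j ≃ b j) → newton a m t ≃ newton b m t
  newton-cong zero    t eq = refl
  newton-cong (suc m) t eq =
    +-cong (newton-cong m t λ j j<m → eq j (ℕ.m<n⇒m<1+n j<m)) (*-congʳ (eq m ℕ.≤-refl))

  newton-congᵗ : ∀ a m {t u} → t ≃ u → newton a m t ≃ newton a m u
  newton-congᵗ a zero    t≃u = refl
  newton-congᵗ a (suc m) t≃u = +-cong (newton-congᵗ a m t≃u) (*-congˡ (falling-cong m t≃u))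

  newton-scale : ∀ c a m t → newton (λ j → c * a j) m t ≃ c * newton a m t
  newton-scale c a zero    t = sym (zeroʳ c)
  newton-scale c a (suc m) t = trans (+-congʳ (newton-scale c a m t))
    (solve 4 (λ c x y z → c :* x :+ c :* y :* z := c :* (x :+ y :* z))
      refl c (newton a m t) (a m) (falling t m))

  newton-extend : ∀ a m k t → (∀ j → m ≤ j → a j ≃ 0#) → newton a (k ℕ.+ m) t ≃ newton a m t
  newton-extend a m zero    t eq = refl
  newton-extend a m (suc k) t eq = begin
    newton a (k ℕ.+ m) t + a (k ℕ.+ m) * falling t (k ℕ.+ m)
      ≈⟨ +-cong (newton-extend a m k t eq) (*-congʳ (eq (k ℕ.+ m) (ℕ.m≤n+m m k))) ⟩
    newton a m t + 0# * falling t (k ℕ.+ m)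
      ≈⟨ solve 2 (λ x f → x :+ con (+ 0) :* f := x) refl (newton a m t) (falling t (k ℕ.+ m)) ⟩
    newton a m t ∎

  -- `sum` peels off its first term, `newton` its last. The bridge is `prefix`, which recurses like
  -- `newton` and is shown to satisfy the recursion of `sum`.
  newton-sum : ∀ (f : ℕ → ℂ) a m t → (∀ j → j < m → f j ≃ a j * falling t j) →
               sum {m} (f ∘ toℕ) ≃ newton a m t
  newton-sum f a m t eq = trans (go f m) (cong′ m eq)
    where
    prefix : (ℕ → ℂ) → ℕ → ℂ
    prefix f zero    = 0#
    prefix f (suc m) = prefix f m + f m

    prefix-suc : ∀ f m → prefix f (suc m) ≃ f 0 + prefix (f ∘ suc) m
    prefix-suc f zero    = trans (+-identityˡ _) (sym (+-identityʳ _))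
    prefix-suc f (suc m) = trans (+-congʳ (prefix-suc f m)) (+-assoc _ _ _)

    go : ∀ f m → sum {m} (f ∘ toℕ) ≃ prefix f m
    go f zero    = refl
    go f (suc m) = trans (+-congˡ (go (f ∘ suc) m)) (sym (prefix-suc f m))

    cong′ : ∀ m → (∀ j → j < m → f j ≃ a j * falling t j) → prefix f m ≃ newton a m t
    cong′ zero    eq = refl
    cong′ (suc m) eq = +-cong (cong′ m λ j j<m → eq j (ℕ.m<n⇒m<1+n j<m)) (eq m ℕ.≤-refl)

  -- The coefficients of the discrete derivative, by the rule Δ[t]_(j+1) = (j + 1)[t]_j.
  shift : (ℕ → ℂ) → ℕ → ℂ
  shift a j = fromℕ (suc j) * a (suc j)

  Δ-newton : ∀ a m t → newton a (suc m) (t + 1#) - newton a (suc m) t ≃ newton (shift a) m t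
  Δ-newton a zero    t = solve 1 (λ x → (con (+ 0) :+ x :* con (+ 1)) :- (con (+ 0) :+ x :* con (+ 1)) := con (+ 0)) refl (a 0)
  Δ-newton a (suc m) t = begin
    (N₁ + c * f₁) - (N₀ + c * f₀)   ≈⟨ solve 5 (λ N₁ N₀ c f₁ f₀ →
                                         (N₁ :+ c :* f₁) :- (N₀ :+ c :* f₀) := (N₁ :- N₀) :+ c :* (f₁ :- f₀))
                                         refl N₁ N₀ c f₁ f₀ ⟩
    (N₁ - N₀) + c * (f₁ - f₀)       ≈⟨ +-cong (Δ-newton a m t) (*-congˡ (Δ-falling t m)) ⟩
    newton (shift a) m t + c * (fromℕ (suc m) * falling t m)
      ≈⟨ +-congˡ (solve 3 (λ c k f → c :* (k :* f) := k :* c :* f) refl c (fromℕ (suc m)) (falling t m)) ⟩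
    newton (shift a) m t + shift a m * falling t m ∎
    where
    N₁ = newton a (suc m) (t + 1#)
    N₀ = newton a (suc m) t
    c  = a (suc m)
    f₁ = falling (t + 1#) (suc m)
    f₀ = falling t (suc m)

  newton-constant : ∀ a m t → (∀ j → j < m → a (suc j) ≃ 0#) → newton a (suc m) t ≃ a 0
  newton-constant a m t eq = begin
    newton a (suc m) t    ≈⟨ newton-cong (suc m) t same ⟩
    newton b (suc m) t    ≡⟨ ≡.cong (λ k → newton b k t) (ℕ.+-comm 1 m) ⟩
    newton b (m ℕ.+ 1) t  ≈⟨ newton-extend b 1 m t (λ { (suc j) _ → refl }) ⟩
    newton b 1 t          ≈⟨ solve 1 (λ x → con (+ 0) :+ x :* con (+ 1) := x) refl (a 0) ⟩
    a 0                   ∎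
    where
    b : ℕ → ℂ
    b zero    = a 0
    b (suc j) = 0#

    same : ∀ j → j < suc m → a j ≃ b j
    same zero    _         = refl
    same (suc j) (s≤s j<m) = eq j j<m

  -- Differencing reduces m consecutive zeros of a polynomial of degree < m to
  -- m − 1 consecutive zeros of one of degree < m − 1.
  newton-zeros : ∀ m b k → (∀ i → i < m → newton b m (fromℕ (k ℕ.+ i)) ≃ 0#) →
                 ∀ j → j < m → b j ≃ 0#
  newton-zeros (suc m) b k vanish = λ where
      -- Once the higher coefficients vanish the polynomial is constant, and one of its zeros kills
      -- the constant.
      zero    _         → trans (sym (newton-constant b m (fromℕ (k ℕ.+ 0)) higher)) (vanish 0 (s≤s z≤n))
      (suc j) (s≤s j<m) → higher j j<m
    where
    Δ-vanish : ∀ i → i < m → newton (shift b) m (fromℕ (k ℕ.+ i)) ≃ 0#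
    Δ-vanish i i<m = begin
      newton (shift b) m t                                  ≈⟨ Δ-newton b m t ⟨
      newton b (suc m) (t + 1#) - newton b (suc m) t        ≈⟨ +-cong (newton-congᵗ b (suc m) t+1) (-‿cong (vanish i (ℕ.m<n⇒m<1+n i<m))) ⟩
      newton b (suc m) (fromℕ (k ℕ.+ suc i)) - 0#           ≈⟨ +-congʳ (vanish (suc i) (s≤s i<m)) ⟩
      0# - 0#                                               ≈⟨ -‿inverseʳ 0# ⟩
      0#                                                    ∎
      where
      t = fromℕ (k ℕ.+ i)
      t+1 : t + 1# ≃ fromℕ (k ℕ.+ suc i)
      t+1 = trans (+-comm _ _) (reflexive (≡.cong fromℕ (≡.sym (ℕ.+-suc k i))))

    higher : ∀ j → j < m → b (suc j) ≃ 0#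
    higher j j<m = *-fromℕ-≃0 (suc j) (trans (*-comm _ _) (newton-zeros m (shift b) k Δ-vanish j j<m))

  Degree≤ : Poly → ℕ → Set
  Degree≤ p d = ∀ k → d < k → coeff p k ≃ 0#

  -- Horner's scheme in the falling basis: since t[t]_j = [t]_(j+1) + j[t]_j, multiplication by `t`
  -- turns the coefficients a_j into a_(j-1) + j a_j.
  coeffⁿ : Poly → ℕ → ℂ
  coeffⁿ []      j       = 0#
  coeffⁿ (c ∷ p) zero    = c
  coeffⁿ (c ∷ p) (suc j) = coeffⁿ p j + fromℕ (suc j) * coeffⁿ p (suc j)

  private
    0+k*0 : ∀ k {z w} → z ≃ 0# → w ≃ 0# → z + k * w ≃ 0#
    0+k*0 k z≃0 w≃0 = trans (+-cong z≃0 (*-congˡ w≃0))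
      (solve 1 (λ k → con (+ 0) :+ k :* con (+ 0) := con (+ 0)) refl k)

  coeffⁿ-length : ∀ p j → length p ≤ j → coeffⁿ p j ≃ 0#
  coeffⁿ-length []      j       _         = refl
  coeffⁿ-length (c ∷ p) (suc j) (s≤s l≤j) =
    0+k*0 _ (coeffⁿ-length p j l≤j) (coeffⁿ-length p (suc j) (ℕ.m≤n⇒m≤1+n l≤j))

  coeffⁿ-zero : ∀ p → (∀ k → coeff p k ≃ 0#) → ∀ j → coeffⁿ p j ≃ 0#
  coeffⁿ-zero []      p≃0 j       = refl
  coeffⁿ-zero (c ∷ p) p≃0 zero    = p≃0 0
  coeffⁿ-zero (c ∷ p) p≃0 (suc j) =
    0+k*0 _ (coeffⁿ-zero p (p≃0 ∘ suc) j) (coeffⁿ-zero p (p≃0 ∘ suc) (suc j))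

  -- Lists may end in zeros, so the degree has to be read from the coefficients rather than from the
  -- length.
  coeffⁿ-above : ∀ p d → Degree≤ p d → ∀ j → d < j → coeffⁿ p j ≃ 0#
  coeffⁿ-above []      d       deg j       _         = refl
  coeffⁿ-above (c ∷ p) zero    deg (suc j) _         =
    0+k*0 _ (coeffⁿ-zero p tail j) (coeffⁿ-zero p tail (suc j))
    where tail = λ k → deg (suc k) (s≤s z≤n)
  coeffⁿ-above (c ∷ p) (suc d) deg (suc j) (s≤s d<j) =
    0+k*0 _ (ih j d<j) (ih (suc j) (ℕ.m<n⇒m<1+n d<j))
    where ih = coeffⁿ-above p d λ k d<k → deg (suc k) (s≤s d<k)

  -- The change of basis is unitriangular, falling factorials being monic.
  coeffⁿ-leading : ∀ p d → Degree≤ p d → coeffⁿ p d ≃ coeff p d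
  coeffⁿ-leading []      d       deg = refl
  coeffⁿ-leading (c ∷ p) zero    deg = refl
  coeffⁿ-leading (c ∷ p) (suc d) deg = begin
    coeffⁿ p d + fromℕ (suc d) * coeffⁿ p (suc d)   ≈⟨ +-cong (coeffⁿ-leading p d deg′) (*-congˡ (coeffⁿ-above p d deg′ (suc d) ℕ.≤-refl)) ⟩
    coeff p d + fromℕ (suc d) * 0#                  ≈⟨ solve 2 (λ c k → c :+ k :* con (+ 0) := c) refl (coeff p d) (fromℕ (suc d)) ⟩
    coeff p d                                       ∎
    where deg′ = λ k d<k → deg (suc k) (s≤s d<k)

  eval-newton-length : ∀ p t → eval p t ≃ newton (coeffⁿ p) (length p) t
  eval-newton-length []      t = refl
  eval-newton-length (c ∷ p) t = sym (begin
    newton (coeffⁿ (c ∷ p)) (suc l) t                                   ≈⟨ horner l ⟩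
    c + t * newton (coeffⁿ p) l t + fromℕ l * coeffⁿ p l * falling t l  ≈⟨ +-cong (+-congˡ (*-congˡ (sym (eval-newton-length p t)))) (*-congʳ (*-congˡ (coeffⁿ-length p l ℕ.≤-refl))) ⟩
    c + t * eval p t + fromℕ l * 0# * falling t l                       ≈⟨ solve 3 (λ x k f → x :+ k :* con (+ 0) :* f := x) refl (c + t * eval p t) (fromℕ l) (falling t l) ⟩
    c + t * eval p t                                                    ∎)
    where
    l = length p

    -- Up to an intermediate `m` the terms j a_j [t]_j telescope and leave the remainder with
    -- `j = m`, which is zero when `m` reaches `length p`.
    horner : ∀ m → newton (coeffⁿ (c ∷ p)) (suc m) t ≃
                   c + t * newton (coeffⁿ p) m t + fromℕ m * coeffⁿ p m * falling t m
    horner zero    = solve 3 (λ c t a → con (+ 0) :+ c :* con (+ 1) := c :+ t :* con (+ 0) :+ con (+ 0) :* a :* con (+ 1))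
                       refl c t (coeffⁿ p 0)
    horner (suc m) = trans (+-congʳ (horner m))
      (solve 7 (λ c t N k f a₀ a₁ →
        (c :+ t :* N :+ k :* a₀ :* f) :+ (a₀ :+ (con (+ 1) :+ k) :* a₁) :* (f :* (t :- k)) :=
        c :+ t :* (N :+ a₀ :* f) :+ (con (+ 1) :+ k) :* a₁ :* (f :* (t :- k)))
        refl c t (newton (coeffⁿ p) m t) (fromℕ m) (falling t m) (coeffⁿ p m) (coeffⁿ p (suc m)))

  -- Either of `length p` and `suc d` may be the larger, so both truncations are compared with the
  -- one at their sum.
  eval-newton : ∀ p d → Degree≤ p d → ∀ t → eval p t ≃ newton (coeffⁿ p) (suc d) t
  eval-newton p d deg t = begin
    eval p t                           ≈⟨ eval-newton-length p t ⟩
    newton a (length p) t              ≈⟨ newton-extend a (length p) (suc d) t (coeffⁿ-length p) ⟨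
    newton a (suc d ℕ.+ length p) t    ≡⟨ ≡.cong (λ k → newton a k t) (ℕ.+-comm (suc d) (length p)) ⟩
    newton a (length p ℕ.+ suc d) t    ≈⟨ newton-extend a (suc d) (length p) t (coeffⁿ-above p d deg) ⟩
    newton a (suc d) t                 ∎
    where a = coeffⁿ p

  module _ (n m r : ℂ) where

    -- The left side of the Hahn equation for `r = r₂` and `m = n − r₁`, so that `n - m - r` is r₁ -
    -- r₂. The eigenvalue `e` stays a parameter because `hahn-newton` varies the number of terms
    -- while `e` is fixed.
    hahn : ℂ → (ℂ → ℂ) → ℂ → ℂ
    hahn e f t = (r - t) * (m - t) * (f (t + 1#) - f t)
               + t * (n - m - r + t) * (f (t - 1#) - f t) + e * f t

    hahn-cong : ∀ e {f g} t → (∀ u → f u ≃ g u) → hahn e f t ≃ hahn e g t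
    hahn-cong e t eq =
      +-cong (+-cong (*-congˡ (+-cong (eq _) (-‿cong (eq _)))) (*-congˡ (+-cong (eq _) (-‿cong (eq _)))))
        (*-congˡ (eq _))

    -- The terms of degree j + 2 from the forward and the backward difference cancel, so a falling
    -- factorial is sent to a combination of itself and its predecessor.
    hahn-falling : ∀ e t j → hahn e (λ u → falling u (suc j)) t ≃
      fromℕ (suc j) * (r - fromℕ j) * (m - fromℕ j) * falling t j
        + (e - fromℕ (suc j) * (n + 1# - fromℕ (suc j))) * falling t (suc j)
    hahn-falling e t j = begin
      (r - t) * (m - t) * (falling (t + 1#) (suc j) - g) + t * (n - m - r + t) * (h - g) + e * g
        ≈⟨ +-congʳ (+-cong (*-congˡ (Δ-falling t j))
             (solve 4 (λ t d h g → t :* d :* (h :- g) := d :* (t :* h :- t :* g)) refl t (n - m - r + t) h g)) ⟩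
      (r - t) * (m - t) * (fromℕ (suc j) * f) + (n - m - r + t) * (t * h - t * g) + e * g
        ≈⟨ +-congʳ (+-congˡ (*-congˡ (+-congʳ (falling-−1 t (suc j))))) ⟩
      (r - t) * (m - t) * (fromℕ (suc j) * f) + (n - m - r + t) * (g * (t - fromℕ (suc j)) - t * g) + e * g
        ≈⟨ solve 7 (λ r m n e t j f →
             let :1 = con (+ 1); k = :1 :+ j; g = f :* (t :- j) in
             (r :- t) :* (m :- t) :* (k :* f) :+ (n :- m :- r :+ t) :* (g :* (t :- k) :- t :* g) :+ e :* g :=
             k :* (r :- j) :* (m :- j) :* f :+ (e :- k :* (n :+ :1 :- k)) :* g)
             refl r m n e t (fromℕ j) f ⟩
      fromℕ (suc j) * (r - fromℕ j) * (m - fromℕ j) * f + (e - fromℕ (suc j) * (n + 1# - fromℕ (suc j))) * g ∎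
      where
      f = falling t j
      g = falling t (suc j)
      h = falling (t - 1#) (suc j)

    hahnⁿ : ℂ → (ℕ → ℂ) → ℕ → ℂ
    hahnⁿ e a j = fromℕ (suc j) * (r - fromℕ j) * (m - fromℕ j) * a (suc j)
                + (e - fromℕ j * (n + 1# - fromℕ j)) * a j

    -- The top term is kept apart because its factor vanishes once `e` is the eigenvalue belonging
    -- to degree `d`; what is left has only `d` terms.
    hahn-newton : ∀ e a t d → hahn e (newton a (suc d)) t ≃
      newton (hahnⁿ e a) d t + (e - fromℕ d * (n + 1# - fromℕ d)) * a d * falling t d
    hahn-newton e a t zero    = solve 6 (λ r m n e t a →
      let :0 = con (+ 0); :1 = con (+ 1); c = :0 :+ a :* :1 in
      (r :- t) :* (m :- t) :* (c :- c) :+ t :* (n :- m :- r :+ t) :* (c :- c) :+ e :* c :=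
      :0 :+ (e :- :0 :* (n :+ :1 :- :0)) :* a :* :1) refl r m n e t (a 0)
    hahn-newton e a t (suc d) = begin
      hahn e (newton a (suc (suc d))) t
        ≈⟨ solve 10 (λ A B e N₁ N₀ N₂ c f₁ f₀ f₂ →
             A :* ((N₁ :+ c :* f₁) :- (N₀ :+ c :* f₀)) :+ B :* ((N₂ :+ c :* f₂) :- (N₀ :+ c :* f₀)) :+ e :* (N₀ :+ c :* f₀) :=
             (A :* (N₁ :- N₀) :+ B :* (N₂ :- N₀) :+ e :* N₀) :+ c :* (A :* (f₁ :- f₀) :+ B :* (f₂ :- f₀) :+ e :* f₀))
             refl ((r - t) * (m - t)) (t * (n - m - r + t)) e
             (newton a (suc d) (t + 1#)) (newton a (suc d) t) (newton a (suc d) (t - 1#)) (a (suc d))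
             (falling (t + 1#) (suc d)) (falling t (suc d)) (falling (t - 1#) (suc d)) ⟩
      hahn e (newton a (suc d)) t + a (suc d) * hahn e (λ u → falling u (suc d)) t
        ≈⟨ +-cong (hahn-newton e a t d) (*-congˡ (hahn-falling e t d)) ⟩
      (newton (hahnⁿ e a) d t + E * a d * falling t d) + a (suc d) * (K * falling t d + E′ * falling t (suc d))
        ≈⟨ solve 8 (λ N E a₀ f a₁ K E′ g →
             (N :+ E :* a₀ :* f) :+ a₁ :* (K :* f :+ E′ :* g) := (N :+ (K :* a₁ :+ E :* a₀) :* f) :+ E′ :* a₁ :* g)
             refl (newton (hahnⁿ e a) d t) E (a d) (falling t d) (a (suc d)) K E′ (falling t (suc d)) ⟩
      newton (hahnⁿ e a) (suc d) t + E′ * a (suc d) * falling t (suc d) ∎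
      where
      E  = e - fromℕ d * (n + 1# - fromℕ d)
      E′ = e - fromℕ (suc d) * (n + 1# - fromℕ (suc d))
      K  = fromℕ (suc d) * (r - fromℕ d) * (m - fromℕ d)

  -- The two-term recurrence and its solution.

  Recurrence : ℕ → ℕ → ℕ → ℕ → (ℕ → ℂ) → Set
  Recurrence n m r s a = ∀ j → j < s →
    fromℕ (suc j) * (fromℕ r - fromℕ j) * (fromℕ m - fromℕ j) * a (suc j)
      ≃ - ((fromℕ s - fromℕ j) * (fromℕ n + 1# - fromℕ s - fromℕ j) * a j)

  hahn-zeros⇒recurrence : ∀ n m r s p k → Degree≤ p s →
    (∀ i → i < s → hahn (fromℕ n) (fromℕ m) (fromℕ r) (fromℕ s * (fromℕ n + 1# - fromℕ s)) (eval p) (fromℕ (k ℕ.+ i)) ≃ 0#) →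
    Recurrence n m r s (coeffⁿ p)
  hahn-zeros⇒recurrence n m r s p k deg vanish j j<s = begin
    -- The source of the product in the recurrence is s(n + 1 - s) - j(n + 1 - j) = (s - j)(n + 1 -
    -- s - j).
    K * a₁                  ≈⟨ solve 5 (λ X s n j a₀ →
                                 let :1 = con (+ 1) in
                                 X := (X :+ (s :* (n :+ :1 :- s) :- j :* (n :+ :1 :- j)) :* a₀)
                                      :- (s :- j) :* (n :+ :1 :- s :- j) :* a₀)
                                 refl (K * a₁) (fromℕ s) (fromℕ n) (fromℕ j) a₀ ⟩
    hahnⁿ (fromℕ n) (fromℕ m) (fromℕ r) e a j - F     ≈⟨ +-congʳ (newton-zeros s _ k newton-vanish j j<s) ⟩
    0# - F                  ≈⟨ +-identityˡ _ ⟩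
    - F                     ∎
    where
    a  = coeffⁿ p
    e  = fromℕ s * (fromℕ n + 1# - fromℕ s)
    K  = fromℕ (suc j) * (fromℕ r - fromℕ j) * (fromℕ m - fromℕ j)
    a₀ = a j
    a₁ = a (suc j)
    F  = (fromℕ s - fromℕ j) * (fromℕ n + 1# - fromℕ s - fromℕ j) * a₀

    newton-vanish : ∀ i → i < s → newton (hahnⁿ (fromℕ n) (fromℕ m) (fromℕ r) e a) s (fromℕ (k ℕ.+ i)) ≃ 0#
    newton-vanish i i<s = begin
      -- The inserted term is the top one of `hahn-newton` for `d = s`, where its factor is `e - e`.
      newton b s t                                  ≈⟨ solve 4 (λ x e c f → x := x :+ (e :- e) :* c :* f) refl (newton b s t) e (a s) (falling t s) ⟩
      newton b s t + (e - e) * a s * falling t s    ≈⟨ hahn-newton _ _ _ e a t s ⟨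
      hahn _ _ _ e (newton a (suc s)) t             ≈⟨ hahn-cong _ _ _ e t (eval-newton p s deg) ⟨
      hahn _ _ _ e (eval p) t                       ≈⟨ vanish i i<s ⟩
      0#                                            ∎
      where
      b = hahnⁿ (fromℕ n) (fromℕ m) (fromℕ r) e a
      t = fromℕ (k ℕ.+ i)

  coeffⁿ-0 : ∀ p → coeffⁿ p 0 ≃ eval p 0#
  coeffⁿ-0 []      = refl
  coeffⁿ-0 (c ∷ p) = solve 2 (λ c x → c := c :+ con (+ 0) :* x) refl c (eval p 0#)

  module ClosedForm {n m r s : ℕ} (s≤r : s ≤ r) (s≤m : s ≤ m) (s≤n∸s : s ≤ n ∸ s) (a : ℕ → ℂ)
                    (a₀ : a 0 ≃ 1#) (rec : Recurrence n m r s a) where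

    private
      x : ℕ
      x = n ∸ s ℕ.+ 1

      s≤x : s ≤ x
      s≤x = ℕ.≤-trans s≤n∸s (ℕ.m≤m+n _ 1)

      fromℕ-x : fromℕ x ≃ fromℕ n + 1# - fromℕ s
      fromℕ-x = begin
        fromℕ (n ∸ s ℕ.+ 1)          ≈⟨ fromℕ-+ (n ∸ s) 1 ⟩
        fromℕ (n ∸ s) + fromℕ 1      ≈⟨ +-cong (fromℕ-∸ (ℕ.≤-trans s≤n∸s (ℕ.m∸n≤m n s))) (+-identityʳ 1#) ⟩
        fromℕ n - fromℕ s + 1#       ≈⟨ solve 2 (λ n s → n :- s :+ con (+ 1) := n :+ con (+ 1) :- s) refl (fromℕ n) (fromℕ s) ⟩
        fromℕ n + 1# - fromℕ s       ∎

    -- The closed form multiplied by its denominators, so that each induction step is one use of the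
    -- recurrence. The factor `j !` is that of `binom`.
    cleared : ∀ j → j ≤ s →
      a j * fromℕ (j !) * (fromℕ (m P j) * fromℕ (r P j)) ≃ (- 1#) ^ j * (fromℕ (s P j) * fromℕ (x P j))
    cleared zero    _   = trans (*-congʳ (*-congʳ a₀))
      (solve 0 (let :1 = con (+ 1); o = :1 :+ con (+ 0) in :1 :* o :* (o :* o) := :1 :* (o :* o)) refl)
    cleared (suc j) j<s = begin
      a₁ * fromℕ (suc j ℕ.* j !) * (fromℕ (m P suc j) * fromℕ (r P suc j))
        ≈⟨ *-cong (*-congˡ (fromℕ-* (suc j) (j !)))
             (*-cong (fromℕ-P-suc (ℕ.<-≤-trans j<s s≤m)) (fromℕ-P-suc (ℕ.<-≤-trans j<s s≤r))) ⟩
      a₁ * (k * f) * ((fromℕ m - fromℕ j) * M * ((fromℕ r - fromℕ j) * Rʲ))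
        ≈⟨ solve 7 (λ a₁ k f mj M rj R → a₁ :* (k :* f) :* (mj :* M :* (rj :* R)) := k :* rj :* mj :* a₁ :* (f :* (M :* R)))
             refl a₁ k f (fromℕ m - fromℕ j) M (fromℕ r - fromℕ j) Rʲ ⟩
      k * (fromℕ r - fromℕ j) * (fromℕ m - fromℕ j) * a₁ * (f * (M * Rʲ))
        ≈⟨ *-congʳ (rec j j<s) ⟩
      - (sj * (fromℕ n + 1# - fromℕ s - fromℕ j) * a j) * (f * (M * Rʲ))
        ≈⟨ *-congʳ (-‿cong (*-congʳ (*-congˡ (+-congʳ fromℕ-x)))) ⟨
      - (sj * xj * a j) * (f * (M * Rʲ))
        ≈⟨ solve 5 (λ sj xj a f MR → :- (sj :* xj :* a) :* (f :* MR) := :- (sj :* xj :* (a :* f :* MR))) refl sj xj (a j) f (M * Rʲ) ⟩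
      - (sj * xj * (a j * f * (M * Rʲ)))
        ≈⟨ -‿cong (*-congˡ (cleared j (ℕ.<⇒≤ j<s))) ⟩
      - (sj * xj * ((- 1#) ^ j * (S * X)))
        ≈⟨ solve 5 (λ sj xj σ S X → :- (sj :* xj :* (σ :* (S :* X))) := (:- con (+ 1)) :* σ :* (sj :* S :* (xj :* X))) refl sj xj ((- 1#) ^ j) S X ⟩
      (- 1#) ^ suc j * (sj * S * (xj * X))
        ≈⟨ *-congˡ (*-cong (fromℕ-P-suc j<s) (fromℕ-P-suc (ℕ.<-≤-trans j<s s≤x))) ⟨
      (- 1#) ^ suc j * (fromℕ (s P suc j) * fromℕ (x P suc j)) ∎
      where
      a₁ = a (suc j)
      k  = fromℕ (suc j)
      f  = fromℕ (j !)
      M  = fromℕ (m P j)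
      Rʲ = fromℕ (r P j)
      S  = fromℕ (s P j)
      X  = fromℕ (x P j)
      sj = fromℕ s - fromℕ j
      xj = fromℕ x - fromℕ j

    private
      denominator≢0 : ∀ {j} → j ≤ s → NonZero ((m P j) ℕ.* (r P j))
      denominator≢0 j≤s = ℕ.m*n≢0 _ _ {{P≢0 (ℕ.≤-trans j≤s s≤m)}} {{P≢0 (ℕ.≤-trans j≤s s≤r)}}

    term : ∀ t j → j ≤ s →
      (- 1#) ^ j * binom t j * (fromℕ ((s P j) ℕ.* (x P j)) / ((m P j) ℕ.* (r P j))) ≃ a j * falling t j
    term t j j≤s = *-fromℕ-cancelʳ (j !) {{j ℕ.!≢0}} (*-fromℕ-cancelʳ D {{D≢0}} (begin
      σ * (falling t j / (j !)) * (A / D) * f * fromℕ D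
        ≈⟨ solve 5 (λ σ b q f D → σ :* b :* q :* f :* D := σ :* (b :* f) :* (q :* D)) refl σ (falling t j / (j !)) (A / D) f (fromℕ D) ⟩
      σ * (falling t j / (j !) * f) * (A / D * fromℕ D)
        ≈⟨ *-cong (*-congˡ (/-* (falling t j) (j !) {{j ℕ.!≢0}})) (trans (/-* A D {{D≢0}}) (fromℕ-* (s P j) (x P j))) ⟩
      σ * falling t j * (fromℕ (s P j) * fromℕ (x P j))
        ≈⟨ solve 3 (λ σ g A → σ :* g :* A := σ :* A :* g) refl σ (falling t j) _ ⟩
      σ * (fromℕ (s P j) * fromℕ (x P j)) * falling t j
        ≈⟨ *-congʳ (cleared j j≤s) ⟨
      a j * f * (fromℕ (m P j) * fromℕ (r P j)) * falling t j
        ≈⟨ *-congʳ (*-congˡ (fromℕ-* (m P j) (r P j))) ⟨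
      a j * f * fromℕ D * falling t j
        ≈⟨ solve 4 (λ a f D g → a :* f :* D :* g := a :* g :* f :* D) refl (a j) f (fromℕ D) (falling t j) ⟩
      a j * falling t j * f * fromℕ D ∎))
      where
      σ = (- 1#) ^ j
      A = fromℕ ((s P j) ℕ.* (x P j))
      D = (m P j) ℕ.* (r P j)
      f = fromℕ (j !)
      D≢0 = denominator≢0 j≤s

    -- The binomial contributes 1/s!, which the numerator [s]_s = s! cancels; hence neither is left
    -- in the leading coefficient.
    leading : a s ≃ (- 1#) ^ s * (fromℕ (x P s) / ((m P s) ℕ.* (r P s)))
    leading = *-fromℕ-cancelʳ (s !) {{s ℕ.!≢0}} (*-fromℕ-cancelʳ D {{D≢0}} (begin
      a s * f * fromℕ D
        ≈⟨ *-congˡ (fromℕ-* (m P s) (r P s)) ⟩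
      a s * f * (fromℕ (m P s) * fromℕ (r P s))
        ≈⟨ cleared s ℕ.≤-refl ⟩
      σ * (fromℕ (s P s) * X)
        ≡⟨ ≡.cong (λ k → σ * (fromℕ k * X)) (nPn≡n! s) ⟩
      σ * (f * X)
        ≈⟨ *-congˡ (*-congˡ (/-* X D {{D≢0}})) ⟨
      σ * (f * (X / D * fromℕ D))
        ≈⟨ solve 4 (λ σ f q D → σ :* (f :* (q :* D)) := σ :* q :* f :* D) refl σ f (X / D) (fromℕ D) ⟩
      σ * (X / D) * f * fromℕ D ∎))
      where
      σ = (- 1#) ^ s
      X = fromℕ (x P s)
      D = (m P s) ℕ.* (r P s)
      f = fromℕ (s !)
      D≢0 = denominator≢0 ℕ.≤-refl

    expansion : ∀ t → sum {suc s} (λ i → let j = toℕ i in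
        (- 1#) ^ j * binom t j * (fromℕ ((s P j) ℕ.* (x P j)) / ((m P j) ℕ.* (r P j))))
      ≃ newton a (suc s) t
    expansion t = newton-sum _ a (suc s) t λ { j (s≤s j≤s) → term t j j≤s }

  -- Lowering n by 2 and m, r, s by 1 turns the recurrence at index j + 1 into the one at index j:
  -- each factor such as s - j depends on a difference that is preserved. So both sides obey the
  -- same recurrence, and the constant is read off at `j = 0`.
  shift-recurrence : ∀ {n m r s} → s ≤ r → s ≤ m → s ≤ n → (a b : ℕ → ℂ) → a 0 ≃ 1# → b 0 ≃ 1# →
    Recurrence (2 ℕ.+ n) (suc m) (suc r) (suc s) a → Recurrence n m r s b →
    ∀ j → j ≤ s →
    shift a j ≃ - (fromℕ (suc s ℕ.* (suc n ∸ s ℕ.+ 1)) / (suc r ℕ.* suc m)) * b j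
  shift-recurrence {n} {m} {r} {s} s≤r s≤m s≤n a b a₀ b₀ recᵃ recᵇ = go
    where
    -- This is n - s + 1 for the larger parameters, as `(2 + n) ∸ suc s` reduces to `suc n ∸ s`.
    x = suc n ∸ s ℕ.+ 1
    A = suc s ℕ.* x
    D = suc r ℕ.* suc m
    Q = fromℕ A / D

    fromℕ-x : fromℕ x ≃ fromℕ (2 ℕ.+ n) - fromℕ s
    fromℕ-x = begin
      fromℕ (suc n ∸ s ℕ.+ 1)            ≈⟨ fromℕ-+ (suc n ∸ s) 1 ⟩
      fromℕ (suc n ∸ s) + fromℕ 1        ≈⟨ +-congʳ (fromℕ-∸ (ℕ.m≤n⇒m≤1+n s≤n)) ⟩
      fromℕ (suc n) - fromℕ s + fromℕ 1  ≈⟨ solve 2 (λ n s → let :1 = con (+ 1) in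
                                              :1 :+ n :- s :+ (:1 :+ con (+ 0)) := :1 :+ (:1 :+ n) :- s)
                                              refl (fromℕ n) (fromℕ s) ⟩
      fromℕ (2 ℕ.+ n) - fromℕ s          ∎

    go : ∀ j → j ≤ s → shift a j ≃ - Q * b j
    go zero    _   = *-fromℕ-cancelʳ D (begin
      fromℕ 1 * a 1 * fromℕ D
        ≈⟨ *-congˡ (fromℕ-* (suc r) (suc m)) ⟩
      fromℕ 1 * a 1 * (fromℕ (suc r) * fromℕ (suc m))
        ≈⟨ solve 4 (λ k a r m → k :* a :* (r :* m) := k :* (r :- con (+ 0)) :* (m :- con (+ 0)) :* a)
             refl (fromℕ 1) (a 1) (fromℕ (suc r)) (fromℕ (suc m)) ⟩
      fromℕ 1 * (fromℕ (suc r) - 0#) * (fromℕ (suc m) - 0#) * a 1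
        ≈⟨ recᵃ 0 (s≤s z≤n) ⟩
      - ((fromℕ (suc s) - 0#) * (fromℕ (2 ℕ.+ n) + 1# - fromℕ (suc s) - 0#) * a 0)
        ≈⟨ -‿cong (*-congˡ a₀) ⟩
      - ((fromℕ (suc s) - 0#) * (fromℕ (2 ℕ.+ n) + 1# - fromℕ (suc s) - 0#) * 1#)
        ≈⟨ solve 2 (λ s n → let :0 = con (+ 0); :1 = con (+ 1) in
             :- ((:1 :+ s :- :0) :* (n :+ :1 :- (:1 :+ s) :- :0) :* :1) := :- ((:1 :+ s) :* (n :- s)))
             refl (fromℕ s) (fromℕ (2 ℕ.+ n)) ⟩
      - (fromℕ (suc s) * (fromℕ (2 ℕ.+ n) - fromℕ s))
        ≈⟨ -‿cong (trans (fromℕ-* (suc s) x) (*-congˡ fromℕ-x)) ⟨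
      - fromℕ A
        ≈⟨ -‿cong (/-* (fromℕ A) D) ⟨
      - (Q * fromℕ D)
        ≈⟨ solve 2 (λ Q D → :- (Q :* D) := (:- Q) :* con (+ 1) :* D) refl Q (fromℕ D) ⟩
      - Q * 1# * fromℕ D
        ≈⟨ *-congʳ (*-congˡ b₀) ⟨
      - Q * b 0 * fromℕ D ∎)
    go (suc j) j<s = *-fromℕ-cancelʳ C {{C≢0}} (begin
      fromℕ (2 ℕ.+ j) * a₂ * fromℕ C
        ≈⟨ *-congˡ fromℕ-C ⟩
      fromℕ (2 ℕ.+ j) * a₂ * (k * (fromℕ r - fromℕ j) * (fromℕ m - fromℕ j))
        ≈⟨ solve 4 (λ a j r m → let :1 = con (+ 1); k = :1 :+ j; l = :1 :+ k in
             l :* a :* (k :* (r :- j) :* (m :- j)) := k :* (l :* (:1 :+ r :- k) :* (:1 :+ m :- k) :* a))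
             refl a₂ (fromℕ j) (fromℕ r) (fromℕ m) ⟩
      k * (fromℕ (2 ℕ.+ j) * (fromℕ (suc r) - k) * (fromℕ (suc m) - k) * a₂)
        ≈⟨ *-congˡ (recᵃ (suc j) (s≤s j<s)) ⟩
      k * - ((fromℕ (suc s) - k) * (fromℕ (2 ℕ.+ n) + 1# - fromℕ (suc s) - k) * a (suc j))
        ≈⟨ solve 4 (λ j s n a → let :1 = con (+ 1); k = :1 :+ j in
             k :* :- ((:1 :+ s :- k) :* (:1 :+ (:1 :+ n) :+ :1 :- (:1 :+ s) :- k) :* a) :=
             :- ((s :- j) :* (n :+ :1 :- s :- j)) :* (k :* a))
             refl (fromℕ j) (fromℕ s) (fromℕ n) (a (suc j)) ⟩
      - (sj * nj) * shift a j
        ≈⟨ *-congˡ (go j (ℕ.<⇒≤ j<s)) ⟩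
      - (sj * nj) * (- Q * b j)
        ≈⟨ solve 4 (λ sj nj Q b → :- (sj :* nj) :* (:- Q :* b) := :- Q :* :- (sj :* nj :* b)) refl sj nj Q (b j) ⟩
      - Q * - (sj * nj * b j)
        ≈⟨ *-congˡ (recᵇ j j<s) ⟨
      - Q * (k * (fromℕ r - fromℕ j) * (fromℕ m - fromℕ j) * b (suc j))
        ≈⟨ *-congˡ (*-congʳ fromℕ-C) ⟨
      - Q * (fromℕ C * b (suc j))
        ≈⟨ solve 3 (λ q c b → q :* (c :* b) := q :* b :* c) refl (- Q) (fromℕ C) (b (suc j)) ⟩
      - Q * b (suc j) * fromℕ C ∎)
      where
      k  = fromℕ (suc j)
      a₂ = a (2 ℕ.+ j)
      C  = suc j ℕ.* (r ∸ j) ℕ.* (m ∸ j)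
      sj = fromℕ s - fromℕ j
      nj = fromℕ n + 1# - fromℕ s - fromℕ j
      j<r = ℕ.<-≤-trans j<s s≤r
      j<m = ℕ.<-≤-trans j<s s≤m

      C≢0 : NonZero C
      C≢0 = ℕ.m*n≢0 _ _
        {{ℕ.m*n≢0 (suc j) _ {{_}} {{ℕ.>-nonZero (ℕ.m<n⇒0<n∸m j<r)}}}} {{ℕ.>-nonZero (ℕ.m<n⇒0<n∸m j<m)}}

      fromℕ-C : fromℕ C ≃ k * (fromℕ r - fromℕ j) * (fromℕ m - fromℕ j)
      fromℕ-C = trans (fromℕ-* (suc j ℕ.* (r ∸ j)) (m ∸ j))
        (*-cong (trans (fromℕ-* (suc j) (r ∸ j)) (*-congˡ (fromℕ-∸ (ℕ.<⇒≤ j<r)))) (fromℕ-∸ (ℕ.<⇒≤ j<m)))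

-- Subsets under permutations, transpositions and moves.

private
  variable
    n s : ℕ

lookup-ext : {x y : Subset n} → (∀ i → lookup x i ≡ lookup y i) → x ≡ y
lookup-ext {x = x} {y} eq =
  ≡.trans (≡.sym (tabulate∘lookup x)) (≡.trans (tabulate-cong eq) (tabulate∘lookup y))

-- ρ g ψ x = ψ (g ⁻¹• x), where g ⁻¹• x is the preimage of x under g.
infixr 7 _⁻¹•_
_⁻¹•_ : Permutation′ n → Subset n → Subset n
g ⁻¹• x = flip g • x

lookup-⁻¹• : ∀ (g : Permutation′ n) x i → lookup (g ⁻¹• x) i ≡ lookup x (g ⟨$⟩ʳ i)
lookup-⁻¹• g x i = lookup∘tabulate _ i

⁻¹•-≔ : ∀ (g : Permutation′ n) z j b → g ⁻¹• (z [ g ⟨$⟩ʳ j ]≔ b) ≡ (g ⁻¹• z) [ j ]≔ b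
⁻¹•-≔ g z j b = lookup-ext λ i → ≡.trans (lookup-⁻¹• g (z [ g ⟨$⟩ʳ j ]≔ b) i) (case i)
  where
  case : ∀ i → lookup (z [ g ⟨$⟩ʳ j ]≔ b) (g ⟨$⟩ʳ i) ≡ lookup ((g ⁻¹• z) [ j ]≔ b) i
  case i with i Fin.≟ j
  ... | yes ≡.refl = ≡.trans (lookup∘update (g ⟨$⟩ʳ i) z b) (≡.sym (lookup∘update i (g ⁻¹• z) b))
  ... | no i≢j = begin
    lookup (z [ g ⟨$⟩ʳ j ]≔ b) (g ⟨$⟩ʳ i)  ≡⟨ lookup∘update′ (i≢j ∘ injective) z b ⟩
    lookup z (g ⟨$⟩ʳ i)                    ≡⟨ lookup-⁻¹• g z i ⟨
    lookup (g ⁻¹• z) i                     ≡⟨ lookup∘update′ i≢j (g ⁻¹• z) b ⟨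
    lookup ((g ⁻¹• z) [ j ]≔ b) i          ∎
    where
    open ≡.≡-Reasoning
    injective : g ⟨$⟩ʳ i ≡ g ⟨$⟩ʳ j → i ≡ j
    injective eq = ≡.trans (≡.sym (inverseˡ g)) (≡.trans (≡.cong (g ⟨$⟩ˡ_) eq) (inverseˡ g))

module ℕSum = CommutativeMonoidSum ℕ.+-0-commutativeMonoid

bit : Bool → ℕ
bit b = if b then 1 else 0

-- As a sum over all points, the cardinality is seen to be invariant by reindexing along the
-- permutation.
∣∣-sum : (x : Subset n) → ∣ x ∣ ≡ ℕSum.sum (bit ∘ lookup x)
∣∣-sum []            = ≡.refl
∣∣-sum (inside  ∷ x) = ≡.cong suc (∣∣-sum x)
∣∣-sum (outside ∷ x) = ∣∣-sum x

∣⁻¹•∣ : ∀ (g : Permutation′ n) x → ∣ g ⁻¹• x ∣ ≡ ∣ x ∣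
∣⁻¹•∣ g x = begin
  ∣ g ⁻¹• x ∣                              ≡⟨ ∣∣-sum (g ⁻¹• x) ⟩
  ℕSum.sum (bit ∘ lookup (g ⁻¹• x))        ≡⟨ ℕSum.sum-cong-≗ (≡.cong bit ∘ lookup-⁻¹• g x) ⟩
  ℕSum.sum (bit ∘ lookup x ∘ (g ⟨$⟩ʳ_))    ≡⟨ ℕSum.sum-permute (bit ∘ lookup x) g ⟨
  ℕSum.sum (bit ∘ lookup x)                ≡⟨ ∣∣-sum x ⟨
  ∣ x ∣                                    ∎
  where open ≡.≡-Reasoning

transposeˡ : ∀ (i j : Fin n) → transpose i j ⟨$⟩ʳ i ≡ j
transposeˡ i j with i Fin.≟ i
... | yes _  = ≡.refl
... | no i≢i = contradiction ≡.refl i≢i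

transposeʳ : ∀ (i j : Fin n) → transpose i j ⟨$⟩ʳ j ≡ i
transposeʳ i j with j Fin.≟ i
... | yes j≡i = j≡i
... | no _ with j Fin.≟ j
...   | yes _  = ≡.refl
...   | no j≢j = contradiction ≡.refl j≢j

transpose-minimal : ∀ {i j k : Fin n} → k ≢ i → k ≢ j → transpose i j ⟨$⟩ʳ k ≡ k
transpose-minimal {i = i} {j} {k} k≢i k≢j with k Fin.≟ i
... | yes k≡i = contradiction k≡i k≢i
... | no _ with k Fin.≟ j
...   | yes k≡j = contradiction k≡j k≢j
...   | no _    = ≡.refl

transpose-involutive : ∀ (i j k : Fin n) → transpose i j ⟨$⟩ʳ (transpose i j ⟨$⟩ʳ k) ≡ k
transpose-involutive i j k with k Fin.≟ i
... | yes ≡.refl = transposeʳ k j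
... | no k≢i with k Fin.≟ j
...   | yes ≡.refl = transposeˡ i k
...   | no k≢j = transpose-minimal k≢i k≢j

transpose-unique : ∀ (i j : Fin n) x y → lookup y i ≡ lookup x j → lookup y j ≡ lookup x i →
                   (∀ k → k ≢ i → k ≢ j → lookup y k ≡ lookup x k) → transpose i j ⁻¹• x ≡ y
transpose-unique i j x y yᵢ yⱼ rest = lookup-ext λ k → ≡.trans (lookup-⁻¹• (transpose i j) x k) (case k)
  where
  case : ∀ k → lookup x (transpose i j ⟨$⟩ʳ k) ≡ lookup y k
  case k with k Fin.≟ i
  ... | yes ≡.refl = ≡.sym yᵢ
  ... | no k≢i with k Fin.≟ j
  ...   | yes ≡.refl = ≡.sym yⱼ
  ...   | no k≢j = ≡.sym (rest k k≢i k≢j)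

transpose-fixes : ∀ (i j : Fin n) x → lookup x i ≡ lookup x j → transpose i j ⁻¹• x ≡ x
transpose-fixes i j x eq = transpose-unique i j x x eq (≡.sym eq) λ _ _ _ → ≡.refl

move : Subset n → Fin n → Fin n → Subset n
move x i j = (x [ i ]≔ outside) [ j ]≔ inside

inside≢outside : inside ≢ outside
inside≢outside ()

lookup-≢ : ∀ (x : Subset n) {i j} → lookup x i ≡ inside → lookup x j ≡ outside → i ≢ j
lookup-≢ x xᵢ xⱼ ≡.refl = inside≢outside (≡.trans (≡.sym xᵢ) xⱼ)

transpose-moves : ∀ (i j : Fin n) x → lookup x i ≡ inside → lookup x j ≡ outside →
                  transpose i j ⁻¹• x ≡ move x i j
transpose-moves i j x xᵢ xⱼ = transpose-unique i j x (move x i j)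
  (≡.trans (lookup∘update′ i≢j (x [ i ]≔ outside) inside) (≡.trans (lookup∘update i x outside) (≡.sym xⱼ)))
  (≡.trans (lookup∘update j (x [ i ]≔ outside) inside) (≡.sym xᵢ))
  λ k k≢i k≢j → ≡.trans (lookup∘update′ k≢j (x [ i ]≔ outside) inside) (lookup∘update′ k≢i x outside)
  where i≢j = lookup-≢ x xᵢ xⱼ

transpose-moves′ : ∀ (i j : Fin n) x → lookup x i ≡ outside → lookup x j ≡ inside →
                   transpose i j ⁻¹• x ≡ move x j i
transpose-moves′ i j x xᵢ xⱼ = transpose-unique i j x (move x j i)
  (≡.trans (lookup∘update i (x [ j ]≔ outside) inside) (≡.sym xⱼ))
  (≡.trans (lookup∘update′ j≢i (x [ j ]≔ outside) inside) (≡.trans (lookup∘update j x outside) (≡.sym xᵢ)))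
  λ k k≢i k≢j → ≡.trans (lookup∘update′ k≢i (x [ j ]≔ outside) inside) (lookup∘update′ k≢j x outside)
  where j≢i = lookup-≢ x xⱼ xᵢ

-- This degenerate move supplies the term `j = i` that completes a sum over the points outside `x`
-- to one over the points outside `x` with `i` removed.
restore : ∀ (x : Subset n) i → lookup x i ≡ inside → move x i i ≡ x
restore x i xᵢ = ≡.trans ([]≔-idempotent x i) (≡.trans (≡.cong (x [ i ]≔_) (≡.sym xᵢ)) ([]≔-lookup x i))

∣─∣-insert : ∀ (y w : Subset n) i → lookup w i ≡ outside →
             ∣ y ─ (w [ i ]≔ inside) ∣ ℕ.+ bit (lookup y i) ≡ ∣ y ─ w ∣
∣─∣-insert (inside  ∷ y) (outside ∷ w) zero    ≡.refl = ℕ.+-comm _ 1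
∣─∣-insert (outside ∷ y) (outside ∷ w) zero    ≡.refl = ℕ.+-identityʳ _
∣─∣-insert (inside  ∷ y) (outside ∷ w) (suc i) wᵢ     = ≡.cong suc (∣─∣-insert y w i wᵢ)
∣─∣-insert (outside ∷ y) (outside ∷ w) (suc i) wᵢ     = ∣─∣-insert y w i wᵢ
∣─∣-insert (_       ∷ y) (inside  ∷ w) (suc i) wᵢ     = ∣─∣-insert y w i wᵢ

-- Both sets arise from `x` without `i` by one insertion. The bits are placed on the two sides to
-- avoid truncated subtraction; their four values are the four kinds of moves.
∣─∣-move : ∀ (y x : Subset n) i j → lookup x i ≡ inside → lookup x j ≡ outside →
           ∣ y ─ (move x i j) ∣ ℕ.+ bit (lookup y j) ≡ ∣ y ─ x ∣ ℕ.+ bit (lookup y i)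
∣─∣-move y x i j xᵢ xⱼ = begin
  ∣ y ─ (move x i j) ∣ ℕ.+ bit (lookup y j)   ≡⟨ ∣─∣-insert y w j (≡.trans (lookup∘update′ (lookup-≢ x xᵢ xⱼ ∘ ≡.sym) x outside) xⱼ) ⟩
  ∣ y ─ w ∣                                   ≡⟨ ∣─∣-insert y w i (lookup∘update i x outside) ⟨
  ∣ y ─ (move x i i) ∣ ℕ.+ bit (lookup y i)   ≡⟨ ≡.cong (λ x′ → ∣ y ─ x′ ∣ ℕ.+ bit (lookup y i)) (restore x i xᵢ) ⟩
  ∣ y ─ x ∣ ℕ.+ bit (lookup y i)              ∎
  where
  open ≡.≡-Reasoning
  w = x [ i ]≔ outside

-- The four blocks are y ∖ x, x ∩ y, x ∖ y and the complement of x ∪ y.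
subsets-in-position : ∀ a b c d → ∃₂ λ (x y : Subset (a ℕ.+ (b ℕ.+ (c ℕ.+ d)))) →
                      ∣ x ∣ ≡ b ℕ.+ c × ∣ y ∣ ≡ a ℕ.+ b × ∣ y ─ x ∣ ≡ a
subsets-in-position zero zero zero zero = [] , [] , ≡.refl , ≡.refl , ≡.refl
subsets-in-position zero zero zero (suc d) =
  let x , y , ex , ey , e = subsets-in-position zero zero zero d in
  outside ∷ x , outside ∷ y , ex , ey , e
subsets-in-position zero zero (suc c) d =
  let x , y , ex , ey , e = subsets-in-position zero zero c d in
  inside ∷ x , outside ∷ y , ≡.cong suc ex , ey , e
subsets-in-position zero (suc b) c d =
  let x , y , ex , ey , e = subsets-in-position zero b c d in
  inside ∷ x , inside ∷ y , ≡.cong suc ex , ≡.cong suc ey , e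
subsets-in-position (suc a) b c d =
  let x , y , ex , ey , e = subsets-in-position a b c d in
  outside ∷ x , inside ∷ y , ex , ≡.cong suc ey , ≡.cong suc e

-- Tableaux: second rows and column exchanges.

∣⁅⁆∪∣ : ∀ (i : Fin n) q → i ∉ q → ∣ ⁅ i ⁆ ∪ q ∣ ≡ suc ∣ q ∣
∣⁅⁆∪∣ zero    (inside  ∷ q) i∉q = contradiction Vec.here i∉q
∣⁅⁆∪∣ zero    (outside ∷ q) i∉q = ≡.cong (λ q′ → suc ∣ q′ ∣) (Subset.∪-identityˡ q)
∣⁅⁆∪∣ (suc i) (inside  ∷ q) i∉q = ≡.cong suc (∣⁅⁆∪∣ i q (i∉q ∘ Vec.there))
∣⁅⁆∪∣ (suc i) (outside ∷ q) i∉q = ∣⁅⁆∪∣ i q (i∉q ∘ Vec.there)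

module _ {A : Set} (f : A → Fin n) where

  private
    -- Shaped so that `secondRow e` is by definition the case `f = cell e` on the list of all
    -- columns.
    image : List A → Subset n
    image js = ⋃ (List.map (λ j → ⁅ f j ⁆) js)

  ∈-image⁺ : ∀ {j js} → j ∈ˡ js → f j ∈ image js
  ∈-image⁺ {js = _ ∷ js} (here ≡.refl) = Subset.p⊆p∪q (image js) (Subset.x∈⁅x⁆ _)
  ∈-image⁺ {js = _ ∷ js} (there j∈js)  = Subset.q⊆p∪q _ (image js) (∈-image⁺ j∈js)

  ∈-image⁻ : ∀ {k} js → k ∈ image js → ∃ λ j → j ∈ˡ js × k ≡ f j
  ∈-image⁻ []       k∈⊥ = contradiction k∈⊥ Subset.∉⊥
  ∈-image⁻ (j ∷ js) k∈ with Subset.x∈p∪q⁻ ⁅ f j ⁆ (image js) k∈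
  ... | inj₁ k∈⁅fj⁆ = j , here ≡.refl , Subset.x∈⁅y⁆⇒x≡y (f j) k∈⁅fj⁆
  ... | inj₂ k∈js   = let j′ , j′∈js , eq = ∈-image⁻ js k∈js in j′ , there j′∈js , eq

  ∣image∣ : (∀ {i j} → f i ≡ f j → i ≡ j) → ∀ {js} → Unique js → ∣ image js ∣ ≡ List.length js
  ∣image∣ injective {[]}     []               = Subset.∣⊥∣≡0 n
  ∣image∣ injective {j ∷ js} (j∉js ∷ distinct) =
    ≡.trans (∣⁅⁆∪∣ (f j) (image js) fj∉) (≡.cong suc (∣image∣ injective distinct))
    where
    fj∉ : f j ∉ image js
    fj∉ fj∈ = let j′ , j′∈js , eq = ∈-image⁻ js fj∈ in All.lookup j∉js j′∈js (injective eq)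

module TableauProperties (T : Tableau n s) where

  open Tableau T

  private
    entry-injective : ∀ {c d} → Inverse.to entry c ≡ Inverse.to entry d → c ≡ d
    entry-injective eq =
      ≡.trans (≡.sym (Inverse.strictlyInverseʳ entry _))
        (≡.trans (≡.cong (Inverse.from entry) eq) (Inverse.strictlyInverseʳ entry _))

  column : Bool → Fin s → Fin n
  column b j = if b then top j else bottom j

  column-injective : ∀ b c {i j} → column b i ≡ column c j → b ≡ c × i ≡ j
  column-injective true  true  eq = ≡.refl , Fin.inject≤-injective _ _ _ _ (inj₁-injective (entry-injective eq))
  column-injective false false eq = ≡.refl , inj₂-injective (entry-injective eq)
  column-injective true  false eq with () ← entry-injective eq
  column-injective false true  eq with () ← entry-injective eq

  cell : Subset s → Fin s → Fin n
  cell e j = column (lookup e j) j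

  ∈-secondRow⁺ : ∀ e j → cell e j ∈ secondRow e
  ∈-secondRow⁺ e j = ∈-image⁺ (cell e) (∈-allFin j)

  ∈-secondRow⁻ : ∀ {k} e → k ∈ secondRow e → ∃ λ j → k ≡ cell e j
  ∈-secondRow⁻ e k∈ = let j , _ , eq = ∈-image⁻ (cell e) (List.allFin s) k∈ in j , eq

  ∣secondRow∣ : ∀ e → ∣ secondRow e ∣ ≡ s
  ∣secondRow∣ e =
    ≡.trans (∣image∣ (cell e) (proj₂ ∘ column-injective _ _) (allFin⁺ s)) (List.length-tabulate {n = s} _)

  toggle : Fin s → Subset s → Subset s
  toggle j e = updateAt e j not

  columnSwap : Fin s → Permutation′ n
  columnSwap j = transpose (top j) (bottom j)

  columnSwap-cell : ∀ j e i → columnSwap j ⟨$⟩ʳ cell e i ≡ cell (toggle j e) i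
  columnSwap-cell j e i with i Fin.≟ j
  ... | yes ≡.refl rewrite lookup∘updateAt i {not} e with lookup e i
  ...   | true  = transposeˡ (top i) (bottom i)
  ...   | false = transposeʳ (top i) (bottom i)
  columnSwap-cell j e i | no i≢j rewrite lookup∘updateAt′ i j {not} i≢j e =
    transpose-minimal (i≢j ∘ proj₂ ∘ column-injective (lookup e i) true)
                      (i≢j ∘ proj₂ ∘ column-injective (lookup e i) false)

  -- The exchange replaces the chosen cell of column `j` by the other one and fixes the cells of the
  -- remaining columns. Since it is an involution, the preimage here is also the image.
  columnSwap-secondRow : ∀ j e → columnSwap j ⁻¹• secondRow e ≡ secondRow (toggle j e)
  columnSwap-secondRow j e = Subset.⊆-antisym forth back
    where
    σ = columnSwap j ⟨$⟩ʳ_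

    forth : ∀ {k} → k ∈ columnSwap j ⁻¹• secondRow e → k ∈ secondRow (toggle j e)
    forth {k} k∈ =
      let σk∈    = lookup⇒[]= (σ k) _ (≡.trans (≡.sym (lookup-⁻¹• (columnSwap j) (secondRow e) k)) ([]=⇒lookup k∈))
          i , eq = ∈-secondRow⁻ e σk∈
          k≡     = ≡.trans (≡.sym (transpose-involutive (top j) (bottom j) k)) (≡.trans (≡.cong σ eq) (columnSwap-cell j e i))
      in ≡.subst (_∈ _) (≡.sym k≡) (∈-secondRow⁺ (toggle j e) i)

    back : ∀ {k} → k ∈ secondRow (toggle j e) → k ∈ columnSwap j ⁻¹• secondRow e
    back {k} k∈ =
      let i , eq = ∈-secondRow⁻ (toggle j e) k∈
          σk≡    = ≡.trans (≡.cong σ (≡.trans eq (≡.sym (columnSwap-cell j e i)))) (transpose-involutive (top j) (bottom j) _)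
      in lookup⇒[]= k _ (≡.trans (lookup-⁻¹• (columnSwap j) (secondRow e) k)
           ([]=⇒lookup (≡.subst (_∈ _) (≡.sym σk≡) (∈-secondRow⁺ e i))))

  -- j is the column of i, and z contains neither of its entries.
  missed-column : ∀ z i e → lookup z i ≡ outside → z [ i ]≔ inside ≡ secondRow e →
                  ∃ λ j → lookup z (top j) ≡ lookup z (bottom j)
  missed-column z i e zᵢ eq
    with j , ≡.refl ← ∈-secondRow⁻ e (≡.subst (i ∈_) eq ([]≔-updates z i)) =
    j , ≡.trans (missed true) (≡.sym (missed false))
    where
    missed : ∀ b → lookup z (column b j) ≡ outside
    missed b with b Bool.≟ lookup e j | lookup z (column b j) in zb
    ... | yes ≡.refl | _     = ≡.trans (≡.sym zb) zᵢ
    ... | no b≢      | false = ≡.refl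
    -- Otherwise the second row would contain both entries of column `j`, whereas it has just one
    -- entry in each column.
    ... | no b≢      | true  =
      let z∪i        = lookup∘update′ (b≢ ∘ proj₁ ∘ column-injective b (lookup e j)) z inside
          k , eq′    = ∈-secondRow⁻ e (≡.subst (column b j ∈_) eq (lookup⇒[]= _ _ (≡.trans z∪i zb)))
          b≡ , j≡k   = column-injective b (lookup e k) eq′
      in contradiction (≡.trans b≡ (≡.cong (lookup e) (≡.sym j≡k))) b≢

-- Harmonic functions and the Laplacian of the transpositions.

module Harmonic (R : RealNumbers) where

  open Representation R
  open ComplexField R
  open SemiringSum semiring using (sum-permute; ∑-distrib-+; ∑-comm; sum-replicate-zero; *-distribˡ-sum; *-distribʳ-sum)

  sum-cong : ∀ {m} {f g : Fin m → ℂ} → (∀ i → f i ≃ g i) → sum f ≃ sum g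
  sum-cong {zero}  eq = refl
  sum-cong {suc m} eq = +-cong (eq zero) (sum-cong (eq ∘ suc))

  neg-sum : ∀ {m} (f : Fin m → ℂ) → sum (λ i → - f i) ≃ - sum f
  neg-sum {zero}  f = solve 0 (con (+ 0) := :- con (+ 0)) refl
  neg-sum {suc m} f = trans (+-congˡ (neg-sum (f ∘ suc)))
    (solve 2 (λ a b → :- a :+ :- b := :- (a :+ b)) refl (f zero) (sum (f ∘ suc)))

  sum-zero : ∀ {m} {f : Fin m → ℂ} → (∀ i → f i ≃ 0#) → sum f ≃ 0#
  sum-zero {m} f≃0 = trans (sum-cong f≃0) (sum-replicate-zero m)

  ∑-cong : ∀ {A : Set} (xs : List A) {f g} → (∀ x → f x ≃ g x) → ∑ xs f ≃ ∑ xs g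
  ∑-cong []       eq = refl
  ∑-cong (x ∷ xs) eq = +-cong (eq x) (∑-cong xs eq)

  ∑-zero : ∀ {A : Set} (xs : List A) {f} → (∀ x → f x ≃ 0#) → ∑ xs f ≃ 0#
  ∑-zero []       eq = refl
  ∑-zero (x ∷ xs) eq = trans (+-cong (eq x) (∑-zero xs eq)) (+-identityˡ _)

  ∑-neg : ∀ {A : Set} (xs : List A) f → ∑ xs (λ x → - f x) ≃ - ∑ xs f
  ∑-neg []       f = solve 0 (con (+ 0) := :- con (+ 0)) refl
  ∑-neg (x ∷ xs) f = trans (+-congˡ (∑-neg xs f))
    (solve 2 (λ a b → :- a :+ :- b := :- (a :+ b)) refl (f x) (∑ xs f))

  ∑-+ : ∀ {A : Set} (xs : List A) f g → ∑ xs (λ x → f x + g x) ≃ ∑ xs f + ∑ xs g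
  ∑-+ []       f g = sym (+-identityˡ _)
  ∑-+ (x ∷ xs) f g = trans (+-congˡ (∑-+ xs f g))
    (solve 4 (λ a b c d → a :+ b :+ (c :+ d) := a :+ c :+ (b :+ d)) refl (f x) (g x) (∑ xs f) (∑ xs g))

  ∑-*ˡ : ∀ {A : Set} (xs : List A) c f → ∑ xs (λ x → c * f x) ≃ c * ∑ xs f
  ∑-*ˡ []       c f = sym (zeroʳ c)
  ∑-*ˡ (x ∷ xs) c f = trans (+-congˡ (∑-*ˡ xs c f)) (sym (distribˡ c (f x) (∑ xs f)))

  ∑-sum : ∀ {A : Set} (xs : List A) {m} (f : Fin m → A → ℂ) →
          ∑ xs (λ x → sum (λ i → f i x)) ≃ sum (λ i → ∑ xs (f i))
  ∑-sum []       {m} f = sym (sum-replicate-zero m)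
  ∑-sum (x ∷ xs) f = trans (+-congˡ (∑-sum xs f)) (sym (∑-distrib-+ (λ i → f i x) (λ i → ∑ xs (f i))))

  ∑-++ : ∀ {A : Set} (xs ys : List A) f → ∑ (xs ++ ys) f ≃ ∑ xs f + ∑ ys f
  ∑-++ []       ys f = sym (+-identityˡ _)
  ∑-++ (x ∷ xs) ys f = trans (+-congˡ (∑-++ xs ys f)) (sym (+-assoc _ _ _))

  ∑-map : ∀ {A B : Set} (h : A → B) xs f → ∑ (List.map h xs) f ≡ ∑ xs (f ∘ h)
  ∑-map h []       f = ≡.refl
  ∑-map h (x ∷ xs) f = ≡.cong₂ _+_ ≡.refl (∑-map h xs f)

  ∑-filter : ∀ {A : Set} {P : A → Set} (P? : Decidable P) xs f → (∀ x → ¬ P x → f x ≃ 0#) →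
             ∑ (filter P? xs) f ≃ ∑ xs f
  ∑-filter P? []       f eq = refl
  ∑-filter P? (x ∷ xs) f eq with P? x
  ... | yes _ = +-congˡ (∑-filter P? xs f eq)
  ... | no ¬p = trans (∑-filter P? xs f eq) (sym (trans (+-congʳ (eq x ¬p)) (+-identityˡ _)))

  ∑-subsets : ∀ n f → ∑ (subsets (suc n)) f ≃
              ∑ (subsets n) (f ∘ (outside ∷_)) + ∑ (subsets n) (f ∘ (inside ∷_))
  ∑-subsets n f = trans (∑-++ (List.map (outside ∷_) (subsets n)) _ f)
    (reflexive (≡.cong₂ _+_ (∑-map (outside ∷_) (subsets n) f) (∑-map (inside ∷_) (subsets n) f)))

  -- Toggling membership of `j` is an involution of the subsets; for the first point it exchanges
  -- the two halves of the list.
  ∑-toggle : ∀ (j : Fin n) f → ∑ (subsets n) f ≃ ∑ (subsets n) (λ e → f (updateAt e j not))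
  ∑-toggle {suc n} zero f = begin
    ∑ (subsets (suc n)) f                                                           ≈⟨ ∑-subsets n f ⟩
    ∑ (subsets n) (f ∘ (outside ∷_)) + ∑ (subsets n) (f ∘ (inside ∷_))              ≈⟨ +-comm _ _ ⟩
    ∑ (subsets n) (f ∘ (inside ∷_)) + ∑ (subsets n) (f ∘ (outside ∷_))              ≈⟨ ∑-subsets n _ ⟨
    ∑ (subsets (suc n)) (λ e → f (updateAt e zero not))                             ∎
  ∑-toggle {suc n} (suc j) f = begin
    ∑ (subsets (suc n)) f                                                           ≈⟨ ∑-subsets n f ⟩
    ∑ (subsets n) (f ∘ (outside ∷_)) + ∑ (subsets n) (f ∘ (inside ∷_))              ≈⟨ +-cong (∑-toggle j _) (∑-toggle j _) ⟩
    ∑ (subsets n) (λ e → f (outside ∷ updateAt e j not)) + ∑ (subsets n) (λ e → f (inside ∷ updateAt e j not))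
                                                                                    ≈⟨ ∑-subsets n _ ⟨
    ∑ (subsets (suc n)) (λ e → f (updateAt e (suc j) not))                          ∎

  sign-toggle : ∀ (j : Fin n) e → (- 1#) ^ ∣ updateAt e j not ∣ ≃ - ((- 1#) ^ ∣ e ∣)
  sign-toggle zero    (inside  ∷ e) = solve 1 (λ σ → σ := :- (:- con (+ 1) :* σ)) refl _
  sign-toggle zero    (outside ∷ e) = solve 1 (λ σ → :- con (+ 1) :* σ := :- σ) refl _
  sign-toggle (suc j) (inside  ∷ e) = trans (*-congˡ (sign-toggle j e))
    (solve 1 (λ σ → :- con (+ 1) :* :- σ := :- (:- con (+ 1) :* σ)) refl _)
  sign-toggle (suc j) (outside ∷ e) = sign-toggle j e

  δ-refl : ∀ (x : Subset n) → δ x x ≡ 1#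
  δ-refl x with ≡-dec Bool._≟_ x x
  ... | yes _  = ≡.refl
  ... | no x≢x = contradiction ≡.refl x≢x

  δ-≢ : ∀ {x y : Subset n} → y ≢ x → δ x y ≡ 0#
  δ-≢ {x = x} {y} y≢x with ≡-dec Bool._≟_ y x
  ... | yes y≡x = contradiction y≡x y≢x
  ... | no _    = ≡.refl

  δ-⇔ : ∀ {m n} {x y : Subset m} {x′ y′ : Subset n} → (y ≡ x → y′ ≡ x′) → (y′ ≡ x′ → y ≡ x) → δ x y ≡ δ x′ y′
  δ-⇔ {x = x} {y} {x′} {y′} to from with ≡-dec Bool._≟_ y x
  ... | no y≢x     = ≡.sym (δ-≢ (y≢x ∘ from))
  ... | yes ≡.refl with ≡.refl ← to ≡.refl = ≡.sym (δ-refl y′)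

  ∑-δ : ∀ (x : Subset n) (h : L² n) → ∑ (subsets n) (λ y → δ x y * h y) ≃ h x
  ∑-δ []      h = solve 1 (λ a → con (+ 1) :* a :+ con (+ 0) := a) refl (h [])
  ∑-δ {suc n} (b ∷ x) h = trans (∑-subsets n _) (halves b)
    where
    same : ∀ b → ∑ (subsets n) (λ y → δ (b ∷ x) (b ∷ y) * h (b ∷ y)) ≃ h (b ∷ x)
    same b = trans
      (∑-cong (subsets n) λ y → *-congʳ (reflexive (δ-⇔ {x = b ∷ x} {b ∷ y} {x} {y} (proj₂ ∘ ∷-injective) (≡.cong (b ∷_)))))
      (∑-δ x (h ∘ (b ∷_)))

    different : ∀ {b c} → c ≢ b → ∑ (subsets n) (λ y → δ (b ∷ x) (c ∷ y) * h (c ∷ y)) ≃ 0#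
    different c≢b = ∑-zero (subsets n) λ y →
      trans (*-congʳ (reflexive (δ-≢ {x = _ ∷ x} {_ ∷ y} (c≢b ∘ proj₁ ∘ ∷-injective)))) (zeroˡ _)

    halves : ∀ b → ∑ (subsets n) (λ y → δ (b ∷ x) (outside ∷ y) * h (outside ∷ y))
                 + ∑ (subsets n) (λ y → δ (b ∷ x) (inside ∷ y) * h (inside ∷ y)) ≃ h (b ∷ x)
    halves outside = trans (+-cong (same outside) (different {outside} {inside} λ ())) (+-identityʳ _)
    halves inside  = trans (+-cong (different {inside} {outside} λ ()) (same inside)) (+-identityˡ _)

  ∑-δ-ofSize : ∀ {r} (x : Subset n) → ∣ x ∣ ≡ r → ∀ (h : L² n) → ∑ (subsetsOfSize n r) (λ y → δ x y * h y) ≃ h x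
  ∑-δ-ofSize {n} x ∣x∣≡r h = trans
    (∑-filter _ (subsets n) _ λ y ∣y∣≢r →
      trans (*-congʳ (reflexive (δ-≢ {x = x} {y} λ { ≡.refl → ∣y∣≢r ∣x∣≡r }))) (zeroˡ (h y)))
    (∑-δ x h)

  𝟏ⁱ 𝟏ᵒ : Bool → ℂ
  𝟏ⁱ b = if b then 1# else 0#
  𝟏ᵒ b = if b then 0# else 1#

  sum-𝟏ⁱ : ∀ (x : Subset n) → sum (𝟏ⁱ ∘ lookup x) ≃ fromℕ ∣ x ∣
  sum-𝟏ⁱ []            = refl
  sum-𝟏ⁱ (inside  ∷ x) = +-congˡ (sum-𝟏ⁱ x)
  sum-𝟏ⁱ (outside ∷ x) = trans (+-identityˡ _) (sum-𝟏ⁱ x)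

  sum-𝟏ᵒ : ∀ (x : Subset n) → sum (𝟏ᵒ ∘ lookup x) ≃ fromℕ n - fromℕ ∣ x ∣
  sum-𝟏ᵒ []            = sym (-‿inverseʳ 0#)
  sum-𝟏ᵒ (inside  ∷ x) = trans (+-congˡ (sum-𝟏ᵒ x))
    (solve 2 (λ n k → con (+ 0) :+ (n :- k) := (con (+ 1) :+ n) :- (con (+ 1) :+ k)) refl _ _)
  sum-𝟏ᵒ (outside ∷ x) = trans (+-congˡ (sum-𝟏ᵒ x))
    (solve 2 (λ n k → con (+ 1) :+ (n :- k) := (con (+ 1) :+ n) :- k) refl _ _)

  -- The lowering operator of the Boolean lattice. An indicator in a sum over all of `Fin n`, in
  -- place of a sum over the complement of `z`, allows reindexing by `sum-permute`.
  down : L² n → L² n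
  down ψ z = sum λ j → 𝟏ᵒ (lookup z j) * ψ (z [ j ]≔ inside)

  down-cong : ∀ {φ ψ : L² n} → (∀ x → φ x ≃ ψ x) → ∀ z → down φ z ≃ down ψ z
  down-cong eq z = sum-cong λ j → *-congˡ (eq (z [ j ]≔ inside))

  down-ρ : ∀ g (ψ : L² n) z → down (ρ g ψ) z ≃ down ψ (g ⁻¹• z)
  down-ρ g ψ z = begin
    sum (λ j → 𝟏ᵒ (lookup z j) * ψ (g ⁻¹• (z [ j ]≔ inside)))
      ≈⟨ sum-permute (λ j → 𝟏ᵒ (lookup z j) * ψ (g ⁻¹• (z [ j ]≔ inside))) g ⟩
    sum (λ j → 𝟏ᵒ (lookup z (g ⟨$⟩ʳ j)) * ψ (g ⁻¹• (z [ g ⟨$⟩ʳ j ]≔ inside)))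
      ≈⟨ sum-cong (λ j → reflexive (≡.cong₂ (λ b y → 𝟏ᵒ b * ψ y)
           (≡.sym (lookup-⁻¹• g z j)) (⁻¹•-≔ g z j inside))) ⟩
    down ψ (g ⁻¹• z) ∎

  record IsHarmonic (s : ℕ) (ψ : L² n) : Set where
    field
      supported : ∀ x → ∣ x ∣ ≢ s → ψ x ≃ 0#
      down-zero : ∀ z → down ψ z ≃ 0#

  open IsHarmonic

  twice-zero : ∀ {z} → z ≃ - z → z ≃ 0#
  twice-zero {z} z≃-z = *-fromℕ-≃0 2 (begin
    z * fromℕ 2   ≈⟨ solve 1 (λ z → z :* (con (+ 1) :+ (con (+ 1) :+ con (+ 0))) := z :+ z) refl z ⟩
    z + z         ≈⟨ +-congˡ z≃-z ⟩
    z - z         ≈⟨ -‿inverseʳ z ⟩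
    0#            ∎)

  module _ (T : Tableau n s) where

    open Tableau T
    open TableauProperties T

    -- Reindexing by the toggle of `j` applies the exchange to every second row and reverses every
    -- sign.
    polytabloid-antisymmetric : ∀ j x → polytabloid T (columnSwap j ⁻¹• x) ≃ - polytabloid T x
    polytabloid-antisymmetric j x = begin
      ∑ (subsets s) (λ e → (- 1#) ^ ∣ e ∣ * δ (secondRow e) (columnSwap j ⁻¹• x))
        ≈⟨ ∑-toggle j _ ⟩
      ∑ (subsets s) (λ e → (- 1#) ^ ∣ toggle j e ∣ * δ (secondRow (toggle j e)) (columnSwap j ⁻¹• x))
        ≈⟨ ∑-cong (subsets s) (λ e → trans (*-cong (sign-toggle j e) (reflexive (δ-⇔ {y′ = x} (to e) (from e))))
             (solve 2 (λ σ d → :- σ :* d := :- (σ :* d)) refl _ (δ (secondRow e) x))) ⟩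
      ∑ (subsets s) (λ e → - ((- 1#) ^ ∣ e ∣ * δ (secondRow e) x))
        ≈⟨ ∑-neg (subsets s) _ ⟩
      - polytabloid T x ∎
      where
      σ = columnSwap j

      σ-involutive : ∀ y → σ ⁻¹• (σ ⁻¹• y) ≡ y
      σ-involutive y = lookup-ext λ k → ≡.trans (lookup-⁻¹• σ (σ ⁻¹• y) k)
        (≡.trans (lookup-⁻¹• σ y (σ ⟨$⟩ʳ k)) (≡.cong (lookup y) (transpose-involutive (top j) (bottom j) k)))

      to : ∀ e → σ ⁻¹• x ≡ secondRow (toggle j e) → x ≡ secondRow e
      to e eq = ≡.trans (≡.sym (σ-involutive x))
        (≡.trans (≡.cong (σ ⁻¹•_) (≡.trans eq (≡.sym (columnSwap-secondRow j e)))) (σ-involutive (secondRow e)))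

      from : ∀ e → x ≡ secondRow e → σ ⁻¹• x ≡ secondRow (toggle j e)
      from e eq = ≡.trans (≡.cong (σ ⁻¹•_) eq) (columnSwap-secondRow j e)

    -- If z treats the two entries of some column alike, exchanging them fixes z and
    -- negates the polytabloid; otherwise no z ∪ {i} is a second row.
    polytabloid-harmonic : IsHarmonic s (polytabloid T)
    polytabloid-harmonic .supported x ∣x∣≢s = ∑-zero (subsets s) λ e →
      trans (*-congˡ (reflexive (δ-≢ {x = secondRow e} {x} λ { ≡.refl → ∣x∣≢s (∣secondRow∣ e) }))) (zeroʳ _)
    polytabloid-harmonic .down-zero z
      with Fin.any? (λ j → lookup z (top j) Bool.≟ lookup z (bottom j))
    ... | yes (j , eq) = twice-zero (begin
      down (polytabloid T) z                           ≡⟨ ≡.cong (down (polytabloid T)) (transpose-fixes (top j) (bottom j) z eq) ⟨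
      down (polytabloid T) (columnSwap j ⁻¹• z)        ≈⟨ down-ρ (columnSwap j) (polytabloid T) z ⟨
      down (ρ (columnSwap j) (polytabloid T)) z        ≈⟨ down-cong (polytabloid-antisymmetric j) z ⟩
      down (λ x → - polytabloid T x) z                 ≈⟨ sum-cong (λ i → solve 2 (λ a b → a :* :- b := :- (a :* b)) refl (𝟏ᵒ (lookup z i)) _) ⟩
      sum (λ i → - (𝟏ᵒ (lookup z i) * polytabloid T (z [ i ]≔ inside)))
                                                       ≈⟨ neg-sum (λ i → 𝟏ᵒ (lookup z i) * polytabloid T (z [ i ]≔ inside)) ⟩
      - down (polytabloid T) z                         ∎)
    ... | no ¬∃ = sum-zero vanish
      where
      vanish : ∀ i → 𝟏ᵒ (lookup z i) * polytabloid T (z [ i ]≔ inside) ≃ 0#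
      vanish i with lookup z i in zᵢ
      ... | true  = zeroˡ _
      ... | false = trans (*-identityˡ _) (∑-zero (subsets s) λ e →
        trans (*-congˡ (reflexive (δ-≢ λ eq → ¬∃ (missed-column z i e zᵢ eq)))) (zeroʳ _))

  ≃-harmonic : ∀ {φ ψ : L² n} → (∀ x → φ x ≃ ψ x) → IsHarmonic s φ → IsHarmonic s ψ
  ≃-harmonic eq h .supported x ∣x∣≢s = trans (sym (eq x)) (h .supported x ∣x∣≢s)
  ≃-harmonic eq h .down-zero z = trans (sym (down-cong eq z)) (h .down-zero z)

  -- Being harmonic is linear and invariant under permutations, so it passes from the polytabloids
  -- to all they generate.
  Specht-harmonic : ∀ {ψ} → Mem (Specht n s) ψ → IsHarmonic s ψ
  Specht-harmonic (gen (T , eq)) = ≃-harmonic (λ x → sym (mk≃ (eq x))) (polytabloid-harmonic T)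
  Specht-harmonic (resp eq m)    = ≃-harmonic (λ x → mk≃ (eq x)) (Specht-harmonic m)
  Specht-harmonic zer .supported _ _ = refl
  Specht-harmonic zer .down-zero z   = sum-zero λ j → zeroʳ (𝟏ᵒ (lookup z j))
  Specht-harmonic (add m m′) .supported x ∣x∣≢s =
    trans (+-cong (Specht-harmonic m .supported x ∣x∣≢s) (Specht-harmonic m′ .supported x ∣x∣≢s)) (+-identityˡ _)
  Specht-harmonic (add {φ} {ψ} m m′) .down-zero z = begin
    down (φ ⊕ ψ) z          ≈⟨ sum-cong (λ j → distribˡ (𝟏ᵒ (lookup z j)) _ _) ⟩
    sum (λ j → 𝟏ᵒ (lookup z j) * φ (z [ j ]≔ inside) + 𝟏ᵒ (lookup z j) * ψ (z [ j ]≔ inside))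
                            ≈⟨ ∑-distrib-+ (λ j → 𝟏ᵒ (lookup z j) * φ (z [ j ]≔ inside)) _ ⟩
    down φ z + down ψ z     ≈⟨ +-cong (Specht-harmonic m .down-zero z) (Specht-harmonic m′ .down-zero z) ⟩
    0# + 0#                 ≈⟨ +-identityˡ 0# ⟩
    0#                      ∎
  Specht-harmonic (scal c m) .supported x ∣x∣≢s = trans (*-congˡ (Specht-harmonic m .supported x ∣x∣≢s)) (zeroʳ c)
  Specht-harmonic (scal c {ψ} m) .down-zero z = begin
    down (c ⊙ ψ) z          ≈⟨ sum-cong (λ j → solve 3 (λ a c b → a :* (c :* b) := c :* (a :* b)) refl (𝟏ᵒ (lookup z j)) c (ψ (z [ j ]≔ inside))) ⟩
    sum (λ j → c * (𝟏ᵒ (lookup z j) * ψ (z [ j ]≔ inside)))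
                            ≈⟨ *-distribˡ-sum c (λ j → 𝟏ᵒ (lookup z j) * ψ (z [ j ]≔ inside)) ⟨
    c * down ψ z            ≈⟨ *-congˡ (Specht-harmonic m .down-zero z) ⟩
    c * 0#                  ≈⟨ zeroʳ c ⟩
    0#                      ∎
  Specht-harmonic (act g m) .supported x ∣x∣≢s =
    Specht-harmonic m .supported (g ⁻¹• x) (∣x∣≢s ∘ ≡.trans (≡.sym (∣⁻¹•∣ g x)))
  Specht-harmonic (act g {ψ} m) .down-zero z =
    trans (down-ρ g ψ z) (Specht-harmonic m .down-zero (g ⁻¹• z))

  -- Over ordered pairs every transposition occurs twice, and `i = j` contributes 0. Only `ρ` and
  -- linear operations enter, so every isomorphism of G-subspaces commutes with it.
  laplacian : L² n → L² n
  laplacian ψ x = sum λ i → sum λ j → ψ (transpose i j ⁻¹• x) - ψ x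

  moves : L² n → L² n
  moves ψ x = sum λ i → sum λ j → 𝟏ⁱ (lookup x i) * 𝟏ᵒ (lookup x j) * (ψ (move x i j) - ψ x)

  -- A transposition changes `x` only when exactly one of its points lies in `x`, and then it is a
  -- move; the two orders of the pair give this move twice.
  laplacian-moves : ∀ (ψ : L² n) x → laplacian ψ x ≃ moves ψ x + moves ψ x
  laplacian-moves ψ x = begin
    laplacian ψ x                                          ≈⟨ sum-cong (λ i → trans (sum-cong (split i)) (∑-distrib-+ (F i) (λ j → F j i))) ⟩
    sum (λ i → sum (F i) + sum (λ j → F j i))              ≈⟨ ∑-distrib-+ (λ i → sum (F i)) _ ⟩
    moves ψ x + sum (λ i → sum (λ j → F j i))              ≈⟨ +-congˡ (∑-comm (λ i j → F j i)) ⟩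
    moves ψ x + moves ψ x                                  ∎
    where
    F : Fin _ → Fin _ → ℂ
    F i j = 𝟏ⁱ (lookup x i) * 𝟏ᵒ (lookup x j) * (ψ (move x i j) - ψ x)

    vanishing : ∀ {a b} → a ≃ 0# → b ≃ 0# → ∀ u v → a * u + b * v ≃ 0#
    vanishing a≃0 b≃0 u v = trans (+-cong (trans (*-congʳ a≃0) (zeroˡ u)) (trans (*-congʳ b≃0) (zeroˡ v))) (+-identityˡ _)

    stays : ∀ {y} → y ≡ x → ψ y - ψ x ≃ 0#
    stays ≡.refl = -‿inverseʳ _

    split : ∀ i j → ψ (transpose i j ⁻¹• x) - ψ x ≃ F i j + F j i
    split i j with lookup x i in xᵢ | lookup x j in xⱼ
    ... | true  | true  = trans (stays (transpose-fixes i j x (≡.trans xᵢ (≡.sym xⱼ))))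
      (sym (vanishing (zeroʳ 1#) (zeroʳ 1#) _ _))
    ... | false | false = trans (stays (transpose-fixes i j x (≡.trans xᵢ (≡.sym xⱼ))))
      (sym (vanishing (zeroˡ 1#) (zeroˡ 1#) _ _))
    ... | true  | false = trans (reflexive (≡.cong (λ y → ψ y - ψ x) (transpose-moves i j x xᵢ xⱼ)))
      (solve 2 (λ u v → u := con (+ 1) :* con (+ 1) :* u :+ con (+ 0) :* con (+ 0) :* v) refl _ (ψ (move x j i) - ψ x))
    ... | false | true  = trans (reflexive (≡.cong (λ y → ψ y - ψ x) (transpose-moves′ i j x xᵢ xⱼ)))
      (solve 2 (λ u v → u := con (+ 0) :* con (+ 0) :* v :+ con (+ 1) :* con (+ 1) :* u) refl _ (ψ (move x i j) - ψ x))
  sum-𝟏ᵒ-remove : ∀ (x : Subset n) i (f : Fin n → ℂ) → lookup x i ≡ inside →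
    sum (λ j → 𝟏ᵒ (lookup (x [ i ]≔ outside) j) * f j) ≃ sum (λ j → 𝟏ᵒ (lookup x j) * f j) + f i
  sum-𝟏ᵒ-remove (inside ∷ x) zero f ≡.refl =
    solve 2 (λ a b → con (+ 1) :* a :+ b := con (+ 0) :* a :+ b :+ a) refl (f zero) _
  sum-𝟏ᵒ-remove (b ∷ x) (suc i) f xᵢ =
    trans (+-congˡ (sum-𝟏ᵒ-remove x i (f ∘ suc) xᵢ)) (sym (+-assoc _ _ _))

  eigenvalue : ℕ → ℕ → ℂ
  eigenvalue n s = fromℕ s * (fromℕ n + 1# - fromℕ s)

  -- For fixed `i` in `x`, the values at `move x i j` with `j` outside `x`, together with `ψ x` as
  -- the term `j = i`, form `down ψ` at `x` without `i` and add up to 0. So each such `i`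
  -- contributes -(n - ∣x∣ + 1) ψ x, and there are ∣x∣ of them.
  moves-harmonic : ∀ {ψ : L² n} → IsHarmonic s ψ → ∀ x →
    moves ψ x ≃ - (fromℕ s * (fromℕ n + 1# - fromℕ s)) * ψ x
  moves-harmonic {n} {s} {ψ} h x = trans (trans (sum-cong row) (sym (*-distribʳ-sum _ (𝟏ⁱ ∘ lookup x)))) scalar
    where
    k = fromℕ ∣ x ∣

    rowsum : ∀ i → lookup x i ≡ inside →
      sum (λ j → 𝟏ᵒ (lookup x j) * (ψ (move x i j) - ψ x)) ≃ - ((fromℕ n + 1# - k) * ψ x)
    rowsum i xᵢ = begin
      sum (λ j → 𝟏ᵒ (lookup x j) * (ψ (move x i j) - ψ x))
        ≈⟨ sum-cong (λ j → solve 3 (λ a b c → a :* (b :- c) := a :* b :+ a :* :- c) refl (𝟏ᵒ (lookup x j)) (ψ (move x i j)) (ψ x)) ⟩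
      sum (λ j → 𝟏ᵒ (lookup x j) * ψ (move x i j) + 𝟏ᵒ (lookup x j) * - ψ x)
        ≈⟨ ∑-distrib-+ (λ j → 𝟏ᵒ (lookup x j) * ψ (move x i j)) _ ⟩
      S + sum (λ j → 𝟏ᵒ (lookup x j) * - ψ x)
        ≈⟨ +-congˡ (*-distribʳ-sum (- ψ x) (𝟏ᵒ ∘ lookup x)) ⟨
      S + sum (𝟏ᵒ ∘ lookup x) * - ψ x
        ≈⟨ +-congˡ (*-congʳ (sum-𝟏ᵒ x)) ⟩
      S + (fromℕ n - k) * - ψ x
        ≈⟨ solve 4 (λ S n k a → S :+ (n :- k) :* :- a := (S :+ a) :+ :- ((n :+ con (+ 1) :- k) :* a)) refl S (fromℕ n) k (ψ x) ⟩
      (S + ψ x) + - ((fromℕ n + 1# - k) * ψ x)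
        ≈⟨ +-congʳ (+-congˡ (reflexive (≡.cong ψ (≡.sym (restore x i xᵢ))))) ⟩
      (S + ψ (move x i i)) + - ((fromℕ n + 1# - k) * ψ x)
        ≈⟨ +-congʳ (sum-𝟏ᵒ-remove x i (λ j → ψ (move x i j)) xᵢ) ⟨
      down ψ (x [ i ]≔ outside) + - ((fromℕ n + 1# - k) * ψ x)
        ≈⟨ trans (+-congʳ (h .down-zero _)) (+-identityˡ _) ⟩
      - ((fromℕ n + 1# - k) * ψ x) ∎
      where S = sum (λ j → 𝟏ᵒ (lookup x j) * ψ (move x i j))

    row : ∀ i → sum (λ j → 𝟏ⁱ (lookup x i) * 𝟏ᵒ (lookup x j) * (ψ (move x i j) - ψ x))
              ≃ 𝟏ⁱ (lookup x i) * - ((fromℕ n + 1# - k) * ψ x)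
    row i with lookup x i in xᵢ
    ... | true  = trans (sum-cong λ j → *-congʳ {ψ (move x i j) - ψ x} (*-identityˡ (𝟏ᵒ (lookup x j)))) (trans (rowsum i xᵢ) (sym (*-identityˡ _)))
    ... | false = trans (sum-zero λ j → trans (*-congʳ {ψ (move x i j) - ψ x} (zeroˡ (𝟏ᵒ (lookup x j)))) (zeroˡ _)) (sym (zeroˡ _))

    scalar : sum (𝟏ⁱ ∘ lookup x) * - ((fromℕ n + 1# - k) * ψ x) ≃ - (fromℕ s * (fromℕ n + 1# - fromℕ s)) * ψ x
    scalar with ∣ x ∣ ℕ.≟ s
    ... | yes ≡.refl = trans (*-congʳ (sum-𝟏ⁱ x))
      (solve 3 (λ k n a → k :* :- ((n :+ con (+ 1) :- k) :* a) := :- (k :* (n :+ con (+ 1) :- k)) :* a) refl k (fromℕ n) (ψ x))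
    -- Off level `s` the count gives another scalar, but there `ψ` is zero.
    ... | no ∣x∣≢s = trans (*-congˡ (-‿cong (*-congˡ ψx≃0)))
      (trans (solve 3 (λ a b c → a :* :- (b :* con (+ 0)) := c :* con (+ 0)) refl _ _ _) (*-congˡ (sym ψx≃0)))
      where ψx≃0 = h .supported x ∣x∣≢s

  laplacian-harmonic : ∀ {ψ : L² n} → IsHarmonic s ψ → ∀ x →
    laplacian ψ x ≃ - (eigenvalue n s + eigenvalue n s) * ψ x
  laplacian-harmonic {n} {s} {ψ} h x = begin
    laplacian ψ x                       ≈⟨ laplacian-moves ψ x ⟩
    moves ψ x + moves ψ x               ≈⟨ +-cong (moves-harmonic h x) (moves-harmonic h x) ⟩
    - e * ψ x + - e * ψ x               ≈⟨ solve 2 (λ e a → :- e :* a :+ :- e :* a := :- (e :+ e) :* a) refl e (ψ x) ⟩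
    - (e + e) * ψ x                     ∎
    where e = eigenvalue n s

  -- An isomorphism acts on members only, so a sum that is to be transported must carry its proof of
  -- membership.
  sumElt : (V : GSubspace n) → ∀ {m} → (Fin m → Elt V) → Elt V
  sumElt V {zero}  u = 𝟘 , 𝟘-closed V
  sumElt V {suc m} u =
    let φ , φ∈V = u zero; ψ , ψ∈V = sumElt V (u ∘ suc) in φ ⊕ ψ , ⊕-closed V φ∈V ψ∈V

  sumElt-value : ∀ (V : GSubspace n) {m} (u : Fin m → Elt V) x →
                 proj₁ (sumElt V u) x ≡ sum (λ i → proj₁ (u i) x)
  sumElt-value V {zero}  u x = ≡.refl
  sumElt-value V {suc m} u x = ≡.cong₂ _+_ ≡.refl (sumElt-value V (u ∘ suc) x)

  −1*≃ : ∀ z → - 1# * z ≃ - z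
  −1*≃ = solve 1 (λ z → :- con (+ 1) :* z := :- z) refl

  differenceElt : (V : GSubspace n) → Elt V → Fin n → Fin n → Elt V
  differenceElt V (φ , φ∈V) i j = ρ (transpose i j) φ ⊕ (- 1#) ⊙ φ ,
    ⊕-closed V (ρ-closed V (transpose i j) φ∈V) (⊙-closed V (- 1#) φ∈V)

  laplacianElt : (V : GSubspace n) → Elt V → Elt V
  laplacianElt V u = sumElt V λ i → sumElt V λ j → differenceElt V u i j

  laplacianElt-value : ∀ (V : GSubspace n) u x → proj₁ (laplacianElt V u) x ≃ laplacian (proj₁ u) x
  laplacianElt-value V u x = begin
    proj₁ (laplacianElt V u) x
      ≡⟨ sumElt-value V (λ i → sumElt V (differenceElt V u i)) x ⟩
    sum (λ i → proj₁ (sumElt V (differenceElt V u i)) x)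
      ≈⟨ sum-cong (λ i → reflexive (sumElt-value V (differenceElt V u i) x)) ⟩
    sum (λ i → sum λ j → proj₁ (differenceElt V u i j) x)
      ≈⟨ sum-cong (λ i → sum-cong λ j → +-congˡ {proj₁ u (transpose i j ⁻¹• x)} (−1*≃ (proj₁ u x))) ⟩
    laplacian (proj₁ u) x ∎

  module _ {V W : GSubspace n} (iso : V ≅ W) where

    open _≅_ iso renaming (cong to to-cong)

    to-sumElt : ∀ {m} (u : Fin m → Elt V) x → proj₁ (to (sumElt V u)) x ≃ sum (λ i → proj₁ (to (u i)) x)
    to-sumElt {zero} u x = begin
      proj₁ (to (𝟘 , 𝟘-closed V)) x
        -- That zero goes to zero follows from homogeneity, after writing `𝟘` as `0# ⊙ 𝟘`.
        ≈⟨ mk≃ (to-cong _ (_ , ⊙-closed V 0# (𝟘-closed V)) (λ y → ≃⇒≈ (sym (zeroˡ 0#))) x) ⟩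
      proj₁ (to (0# ⊙ 𝟘 , ⊙-closed V 0# (𝟘-closed V))) x
        ≈⟨ mk≃ (homogen 0# (𝟘 , 𝟘-closed V) x) ⟩
      0# * proj₁ (to (𝟘 , 𝟘-closed V)) x
        ≈⟨ zeroˡ _ ⟩
      0# ∎
    to-sumElt {suc m} u x = trans (mk≃ (additive (u zero) (sumElt V (u ∘ suc)) x)) (+-congˡ (to-sumElt (u ∘ suc) x))

    to-laplacian : ∀ u x → proj₁ (to (laplacianElt V u)) x ≃ laplacian (proj₁ (to u)) x
    to-laplacian u@(φ , φ∈V) x = begin
      proj₁ (to (laplacianElt V u)) x
        ≈⟨ to-sumElt (λ i → sumElt V (differenceElt V u i)) x ⟩
      sum (λ i → proj₁ (to (sumElt V (differenceElt V u i))) x)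
        ≈⟨ sum-cong (λ i → to-sumElt (differenceElt V u i) x) ⟩
      sum (λ i → sum λ j → proj₁ (to (differenceElt V u i j)) x)
        ≈⟨ sum-cong (λ i → sum-cong (to-difference i)) ⟩
      laplacian (proj₁ (to u)) x ∎
      where
      to-difference : ∀ i j → proj₁ (to (differenceElt V u i j)) x ≃ proj₁ (to u) (transpose i j ⁻¹• x) - proj₁ (to u) x
      to-difference i j = begin
        proj₁ (to (differenceElt V u i j)) x
          ≈⟨ mk≃ (additive (_ , ρ-closed V (transpose i j) φ∈V) (_ , ⊙-closed V (- 1#) φ∈V) x) ⟩
        proj₁ (to (_ , ρ-closed V (transpose i j) φ∈V)) x + proj₁ (to (_ , ⊙-closed V (- 1#) φ∈V)) x
          ≈⟨ +-cong (mk≃ (equivar (transpose i j) u x)) (mk≃ (homogen (- 1#) u x)) ⟩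
        proj₁ (to u) (transpose i j ⁻¹• x) + - 1# * proj₁ (to u) x
          ≈⟨ +-congˡ (−1*≃ (proj₁ (to u) x)) ⟩
        proj₁ (to u) (transpose i j ⁻¹• x) - proj₁ (to u) x ∎

    -- The Laplacian of `φ` and its multiple by `c` have the same image in `W`, so injectivity
    -- identifies them.
    ≅-eigen : ∀ c → (∀ ψ → Mem W ψ → ∀ x → laplacian ψ x ≃ c * ψ x) →
              ∀ φ → Mem V φ → ∀ x → laplacian φ x ≃ c * φ x
    ≅-eigen c eigen φ φ∈V x = trans (sym (laplacianElt-value V u x))
      (mk≃ (injective (laplacianElt V u) (c ⊙ φ , ⊙-closed V c φ∈V) (λ y → ≃⇒≈ (begin
        proj₁ (to (laplacianElt V u)) y          ≈⟨ to-laplacian u y ⟩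
        laplacian (proj₁ (to u)) y               ≈⟨ eigen (proj₁ (to u)) (proj₂ (to u)) y ⟩
        c * proj₁ (to u) y                       ≈⟨ mk≃ (homogen c u y) ⟨
        proj₁ (to (c ⊙ φ , ⊙-closed V c φ∈V)) y  ∎)) x))
      where u = φ , φ∈V

  component-eigen : ∀ {r V} → IsComponent n r s V → ∀ φ → Mem V φ → ∀ x →
                    laplacian φ x ≃ - (eigenvalue n s + eigenvalue n s) * φ x
  component-eigen {n} {s} comp =
    ≅-eigen (IsComponent.isSpecht comp) (- (eigenvalue n s + eigenvalue n s)) λ ψ ψ∈Specht → laplacian-harmonic (Specht-harmonic ψ∈Specht)

-- The eigenvalue equation for the kernel of Λ.

module Kernel (R : RealNumbers) where

  open Representation R
  open ComplexField R
  open Harmonic R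
  open SemiringSum semiring using (∑-distrib-+; *-distribˡ-sum; *-distribʳ-sum)

  private module ℝ = RealNumbers R

  conj-neg : ∀ z → conj (- z) ≃ - conj z
  conj-neg z = mk≃ (ℝ.refl , ℝ.refl)

  conj-0 : conj 0# ≃ 0#
  conj-0 = mk≃ (ℝ.refl , RingProperties.-0#≈0# (CommutativeRing.ring ℝ-commutativeRing))

  conj-1 : conj 1# ≃ 1#
  conj-1 = mk≃ (ℝ.refl , RingProperties.-0#≈0# (CommutativeRing.ring ℝ-commutativeRing))

  conj-fromℕ : ∀ m → conj (fromℕ m) ≃ fromℕ m
  conj-fromℕ zero    = conj-0
  conj-fromℕ (suc m) = trans (conj-+ 1# (fromℕ m)) (+-cong conj-1 (conj-fromℕ m))

  conj-− : ∀ z w → conj (z - w) ≃ conj z - conj w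
  conj-− z w = trans (conj-+ z (- w)) (+-congˡ (conj-neg w))

  conj-eigenvalue : ∀ n s → conj (eigenvalue n s) ≃ eigenvalue n s
  conj-eigenvalue n s = trans (conj-* (fromℕ s) _)
    (*-cong (conj-fromℕ s) (trans (conj-− _ (fromℕ s)) (+-cong (trans (conj-+ (fromℕ n) 1#)
      (+-cong (conj-fromℕ n) conj-1)) (-‿cong (conj-fromℕ s)))))

  conj-sum : ∀ {m} (f : Fin m → ℂ) → conj (sum f) ≃ sum (conj ∘ f)
  conj-sum {zero}  f = conj-0
  conj-sum {suc m} f = trans (conj-+ (f zero) (sum (f ∘ suc))) (+-congˡ (conj-sum (f ∘ suc)))

  conj-laplacian : ∀ (φ : L² n) x → conj (laplacian φ x) ≃ laplacian (conj ∘ φ) x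
  conj-laplacian {n} φ x = begin
    conj (laplacian φ x)                                 ≈⟨ conj-sum {n} _ ⟩
    sum (λ i → conj (sum λ j → φ (transpose i j ⁻¹• x) - φ x))
                                                         ≈⟨ sum-cong (λ i → conj-sum (λ j → φ (transpose i j ⁻¹• x) - φ x)) ⟩
    sum (λ i → sum λ j → conj (φ (transpose i j ⁻¹• x) - φ x))
                                                         ≈⟨ sum-cong (λ i → sum-cong λ j → conj-− (φ (transpose i j ⁻¹• x)) (φ x)) ⟩
    laplacian (conj ∘ φ) x                               ∎

  -- Pairing with this function evaluates (laplacian + c) at x; it is orthogonal to
  -- an eigenspace for −c, so Λ kills it.
  testFunction : ℂ → Subset n → L² n
  testFunction c x y = laplacian (λ x′ → δ x′ y) x + c * δ x y

  module _ (ys : List (Subset n)) (h : L² n) (x : Subset n)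
           (∑-δ≃ : ∀ x′ → ∣ x′ ∣ ≡ ∣ x ∣ → ∑ ys (λ y → δ x′ y * h y) ≃ h x′) where

    -- The list `ys` is left open to serve both the inner product over all subsets and the kernel
    -- sum over one size. As transpositions preserve size, point evaluation is asked only at sets as
    -- large as `x`.
    ∑-testFunction : ∀ c → ∑ ys (λ y → testFunction c x y * h y) ≃ laplacian h x + c * h x
    ∑-testFunction c = begin
      ∑ ys (λ y → testFunction c x y * h y)
        ≈⟨ ∑-cong ys (λ y → trans (distribʳ (h y) _ _) (+-cong (expand y) (*-assoc c (δ x y) (h y)))) ⟩
      ∑ ys (λ y → sum (λ i → sum λ j → D i j y) + c * (δ x y * h y))
        ≈⟨ ∑-+ ys _ _ ⟩
      ∑ ys (λ y → sum (λ i → sum λ j → D i j y)) + ∑ ys (λ y → c * (δ x y * h y))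
        ≈⟨ +-cong (∑-sum ys (λ i y → sum λ j → D i j y)) (∑-*ˡ ys c (λ y → δ x y * h y)) ⟩
      sum (λ i → ∑ ys (λ y → sum λ j → D i j y)) + c * ∑ ys (λ y → δ x y * h y)
        ≈⟨ +-cong (sum-cong (λ i → ∑-sum ys (D i))) (*-congˡ (∑-δ≃ x ≡.refl)) ⟩
      sum (λ i → sum λ j → ∑ ys (D i j)) + c * h x
        ≈⟨ +-congʳ (sum-cong (λ i → sum-cong (collapse i))) ⟩
      laplacian h x + c * h x ∎
      where
      D : Fin n → Fin n → Subset n → ℂ
      D i j y = δ (transpose i j ⁻¹• x) y * h y + - (δ x y * h y)

      expand : ∀ y → laplacian (λ x′ → δ x′ y) x * h y ≃ sum (λ i → sum λ j → D i j y)
      expand y = trans (*-distribʳ-sum (h y) (λ i → sum λ j → δ (transpose i j ⁻¹• x) y - δ x y))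
        (sum-cong λ i → trans (*-distribʳ-sum (h y) (λ j → δ (transpose i j ⁻¹• x) y - δ x y))
          (sum-cong λ j → solve 3 (λ a b c → (a :- b) :* c := a :* c :+ :- (b :* c))
            refl (δ (transpose i j ⁻¹• x) y) (δ x y) (h y)))

      collapse : ∀ i j → ∑ ys (D i j) ≃ h (transpose i j ⁻¹• x) - h x
      collapse i j = trans (∑-+ ys _ _)
        (+-cong (∑-δ≃ _ (∣⁻¹•∣ (transpose i j) x)) (trans (∑-neg ys _) (-‿cong (∑-δ≃ x ≡.refl))))

  -- The pairing conjugates its second argument and so produces the conjugate of the Laplacian of
  -- `φ` plus `c φ` at `x`, provided that `c` is real.
  testFunction-orthogonal : ∀ {c} (φ : L² n) x → conj c ≃ c → laplacian φ x ≃ - c * φ x →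
                            ⟨ testFunction c x , φ ⟩ ≃ 0#
  testFunction-orthogonal {n} {c} φ x real eigen = begin
    ⟨ testFunction c x , φ ⟩                          ≈⟨ ∑-testFunction (subsets n) (conj ∘ φ) x (λ x′ _ → ∑-δ x′ (conj ∘ φ)) c ⟩
    laplacian (conj ∘ φ) x + c * conj (φ x)           ≈⟨ +-congʳ (conj-laplacian φ x) ⟨
    conj (laplacian φ x) + c * conj (φ x)             ≈⟨ +-congʳ (trans (conj-cong eigen) (trans (conj-* (- c) (φ x)) (*-congʳ (trans (conj-neg c) (-‿cong real))))) ⟩
    - c * conj (φ x) + c * conj (φ x)                 ≈⟨ solve 2 (λ c a → :- c :* a :+ c :* a := con (+ 0)) refl c (conj (φ x)) ⟩
    0#                                                ∎

  module _ {r₁ r₂ : ℕ} {V₁ V₂ : GSubspace n} {Λ : L² n → L² n} {κ : ℕ → ℂ}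
           (comp : IsComponent n r₁ s V₁) (isΛ : IsIntertwinerWithKernel n r₁ r₂ V₁ V₂ Λ κ) where

    open IsIntertwinerWithKernel isΛ

    -- The kernel formula for Λ of the test function, evaluated at `y`, is the eigenvalue equation
    -- at `x` for the function `x′ ↦ κ ∣ y ─ x′ ∣`. The doubled eigenvalue matches the two copies in
    -- `laplacian-moves`, and the common 2 is cancelled.
    kernel-eigen : ∀ (x y : Subset n) → ∣ x ∣ ≡ r₁ → ∣ y ∣ ≡ r₂ →
      moves (λ x′ → κ ∣ y ─ x′ ∣) x + eigenvalue n s * κ ∣ y ─ x ∣ ≃ 0#
    kernel-eigen x y ∣x∣ ∣y∣ = *-fromℕ-≃0 2 (begin
      (moves h x + e * h x) * fromℕ 2
        ≈⟨ solve 3 (λ m e a → (m :+ e :* a) :* (con (+ 1) :+ (con (+ 1) :+ con (+ 0))) := m :+ m :+ (e :+ e) :* a) refl (moves h x) e (h x) ⟩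
      moves h x + moves h x + (e + e) * h x
        ≈⟨ +-congʳ (laplacian-moves h x) ⟨
      laplacian h x + (e + e) * h x
        ≈⟨ ∑-testFunction (subsetsOfSize n r₁) h x (λ x′ eq → ∑-δ-ofSize x′ (≡.trans eq ∣x∣) h) (e + e) ⟨
      ∑ (subsetsOfSize n r₁) (λ x₁ → ψ x₁ * h x₁)
        ≈⟨ ∑-cong (subsetsOfSize n r₁) (λ x₁ → *-comm (ψ x₁) (h x₁)) ⟩
      ∑ (subsetsOfSize n r₁) (λ x₁ → h x₁ * ψ x₁)
        ≈⟨ mk≃ (kernel ψ y ∣y∣) ⟨
      Λ ψ y
        ≈⟨ mk≃ (vanishes ψ (λ φ φ∈V₁ → ≃⇒≈ (testFunction-orthogonal φ x real (component-eigen comp φ φ∈V₁ x))) y) ⟩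
      0# ∎)
      where
      e = eigenvalue n s
      ψ = testFunction (e + e) x
      h : L² n
      h x′ = κ ∣ y ─ x′ ∣
      real : conj (e + e) ≃ e + e
      real = trans (conj-+ e e) (+-cong (conj-eigenvalue n s) (conj-eigenvalue n s))

  module _ (x y : Subset n) where

    private
      xⁱ xᵒ yⁱ yᵒ : Fin n → ℂ
      xⁱ = 𝟏ⁱ ∘ lookup x
      xᵒ = 𝟏ᵒ ∘ lookup x
      yⁱ = 𝟏ⁱ ∘ lookup y
      yᵒ = 𝟏ᵒ ∘ lookup y

      X = fromℕ ∣ x ∣
      Y = fromℕ ∣ y ∣
      k = ∣ y ─ x ∣

    count-─ : sum (λ j → xᵒ j * yⁱ j) ≃ fromℕ k
    count-─ = go x y
      where
      go : ∀ {n} (x y : Subset n) → sum (λ j → 𝟏ᵒ (lookup x j) * 𝟏ⁱ (lookup y j)) ≃ fromℕ ∣ y ─ x ∣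
      go []            []            = refl
      go (inside  ∷ x) (b       ∷ y) = trans (+-cong (zeroˡ (𝟏ⁱ b)) (go x y)) (+-identityˡ _)
      go (outside ∷ x) (inside  ∷ y) = +-cong (*-identityˡ 1#) (go x y)
      go (outside ∷ x) (outside ∷ y) = trans (+-cong (zeroʳ 1#) (go x y)) (+-identityˡ _)

    private
      𝟏ⁱ+𝟏ᵒ : ∀ b → 𝟏ⁱ b + 𝟏ᵒ b ≃ 1#
      𝟏ⁱ+𝟏ᵒ true  = +-identityʳ 1#
      𝟏ⁱ+𝟏ᵒ false = +-identityˡ 1#

      split : ∀ (f g p q : Fin n → ℂ) → (∀ j → f j + g j ≃ 1#) → (∀ j → p j ≃ f j * q j) →
              sum p ≃ sum q - sum (λ j → g j * q j)
      split f g p q f+g p≃ = begin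
        sum p                                             ≈⟨ solve 2 (λ a b → a := (a :+ b) :- b) refl (sum p) G ⟩
        (sum p + G) - G                                   ≈⟨ +-congʳ (∑-distrib-+ p (λ j → g j * q j)) ⟨
        sum (λ j → p j + g j * q j) - G                   ≈⟨ +-congʳ (sum-cong λ j → trans (+-congʳ (p≃ j))
                                                               (trans (sym (distribʳ (q j) (f j) (g j))) (trans (*-congʳ (f+g j)) (*-identityˡ (q j))))) ⟩
        sum q - G                                         ∎
        where G = sum (λ j → g j * q j)

    count-∩ : sum (λ i → xⁱ i * yⁱ i) ≃ Y - fromℕ k
    count-∩ = trans (split xⁱ xᵒ (λ i → xⁱ i * yⁱ i) yⁱ (𝟏ⁱ+𝟏ᵒ ∘ lookup x) (λ i → refl))
      (+-cong (sum-𝟏ⁱ y) (-‿cong count-─))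

    count-x─y : sum (λ i → xⁱ i * yᵒ i) ≃ X - (Y - fromℕ k)
    count-x─y = trans (split yᵒ yⁱ (λ i → xⁱ i * yᵒ i) xⁱ (λ i → trans (+-comm _ _) (𝟏ⁱ+𝟏ᵒ (lookup y i))) (λ i → *-comm _ _))
      (+-cong (sum-𝟏ⁱ x) (-‿cong (trans (sum-cong λ i → *-comm (yⁱ i) (xⁱ i)) count-∩)))

    count-neither : sum (λ j → xᵒ j * yᵒ j) ≃ (fromℕ n - X) - fromℕ k
    count-neither = trans (split yᵒ yⁱ (λ j → xᵒ j * yᵒ j) xᵒ (λ i → trans (+-comm _ _) (𝟏ⁱ+𝟏ᵒ (lookup y i))) (λ i → *-comm _ _))
      (+-cong (sum-𝟏ᵒ x) (-‿cong (trans (sum-cong λ j → *-comm (yⁱ j) (xᵒ j)) count-─)))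

    sum-product : ∀ (f g : Fin n → ℂ) c → sum (λ i → sum λ j → f i * g j * c) ≃ sum f * sum g * c
    sum-product f g c = begin
      sum (λ i → sum λ j → f i * g j * c)     ≈⟨ sum-cong (λ i → *-distribʳ-sum c (λ j → f i * g j)) ⟨
      sum (λ i → sum (λ j → f i * g j) * c)   ≈⟨ *-distribʳ-sum c (λ i → sum (λ j → f i * g j)) ⟨
      sum (λ i → sum (λ j → f i * g j)) * c   ≈⟨ *-congʳ (sum-cong (λ i → *-distribˡ-sum (f i) g)) ⟨
      sum (λ i → f i * sum g) * c             ≈⟨ *-congʳ (*-distribʳ-sum (sum g) f) ⟨
      sum f * sum g * c                       ∎

    -- The distance rises by one if `i` is in `y` and `j` is not, falls by one in the opposite case,
    -- and otherwise is unchanged. The first kind is counted by the intersection times the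
    -- complement of the union, the second by the two set differences. At `k = 0` the truncated
    -- index `k ∸ 1` has coefficient 0.
    moves-kernel : ∀ (κ : ℕ → ℂ) → moves (λ x′ → κ ∣ y ─ x′ ∣) x ≃
      (Y - fromℕ k) * (fromℕ n - X - fromℕ k) * (κ (suc k) - κ k)
        + (X - (Y - fromℕ k)) * fromℕ k * (κ (k ∸ 1) - κ k)
    moves-kernel κ = begin
      moves h x
        ≈⟨ sum-cong (λ i → sum-cong (classify i)) ⟩
      sum (λ i → sum λ j → up i j + down′ i j)
        ≈⟨ sum-cong (λ i → ∑-distrib-+ (up i) (down′ i)) ⟩
      sum (λ i → sum (up i) + sum (down′ i))
        ≈⟨ ∑-distrib-+ (sum ∘ up) (sum ∘ down′) ⟩
      sum (λ i → sum (up i)) + sum (λ i → sum (down′ i))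
        ≈⟨ +-cong (sum-product _ _ α) (sum-product _ _ β) ⟩
      sum (λ i → xⁱ i * yⁱ i) * sum (λ j → xᵒ j * yᵒ j) * α + sum (λ i → xⁱ i * yᵒ i) * sum (λ j → xᵒ j * yⁱ j) * β
        ≈⟨ +-cong (*-congʳ (*-cong count-∩ count-neither)) (*-congʳ (*-cong count-x─y count-─)) ⟩
      (Y - fromℕ k) * (fromℕ n - X - fromℕ k) * α + (X - (Y - fromℕ k)) * fromℕ k * β ∎
      where
      h : L² n
      h x′ = κ ∣ y ─ x′ ∣
      α = κ (suc k) - κ k
      β = κ (k ∸ 1) - κ k

      up down′ : Fin n → Fin n → ℂ
      up    i j = xⁱ i * yⁱ i * (xᵒ j * yᵒ j) * α
      down′ i j = xⁱ i * yᵒ i * (xᵒ j * yⁱ j) * β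

      stays : ∀ {m} → m ≡ k → κ m - κ k ≃ 0#
      stays ≡.refl = -‿inverseʳ _

      moved : ∀ i j → lookup x i ≡ inside → lookup x j ≡ outside →
              h (move x i j) - h x ≃ yⁱ i * yᵒ j * α + yᵒ i * yⁱ j * β
      moved i j xᵢ xⱼ with lookup y i | lookup y j | ∣─∣-move y x i j xᵢ xⱼ
      ... | true  | true  | eq = trans (stays (ℕ.+-cancelʳ-≡ 1 _ k eq))
              (solve 2 (λ α β → con (+ 0) := con (+ 1) :* con (+ 0) :* α :+ con (+ 0) :* con (+ 1) :* β) refl α β)
      ... | false | false | eq = trans (stays (ℕ.+-cancelʳ-≡ 0 _ k eq))
              (solve 2 (λ α β → con (+ 0) := con (+ 0) :* con (+ 1) :* α :+ con (+ 1) :* con (+ 0) :* β) refl α β)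
      ... | true  | false | eq = trans
              (reflexive (≡.cong (λ m → κ m - κ k) (≡.trans (≡.sym (ℕ.+-identityʳ _)) (≡.trans eq (ℕ.+-comm k 1)))))
              (solve 2 (λ α β → α := con (+ 1) :* con (+ 1) :* α :+ con (+ 0) :* con (+ 0) :* β) refl α β)
      ... | false | true  | eq = trans
              (reflexive (≡.cong (λ m → κ m - κ k) (≡.cong ℕ.pred (≡.trans (ℕ.+-comm 1 _) (≡.trans eq (ℕ.+-identityʳ k))))))
              (solve 2 (λ α β → β := con (+ 0) :* con (+ 0) :* α :+ con (+ 1) :* con (+ 1) :* β) refl α β)

      classify : ∀ i j → xⁱ i * xᵒ j * (h (move x i j) - h x) ≃ up i j + down′ i j
      classify i j with lookup x i in xᵢ | lookup x j in xⱼ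
      ... | true  | false = trans (*-congˡ (moved i j xᵢ xⱼ)) (solve 6 (λ a b c d α β →
              con (+ 1) :* con (+ 1) :* (a :* b :* α :+ c :* d :* β) :=
              con (+ 1) :* a :* (con (+ 1) :* b) :* α :+ con (+ 1) :* c :* (con (+ 1) :* d) :* β)
              refl (yⁱ i) (yᵒ j) (yᵒ i) (yⁱ j) α β)
      ... | false | b     = solve 8 (λ a b c d α β m o →
              con (+ 0) :* o :* m :=
              con (+ 0) :* a :* (o :* b) :* α :+ con (+ 0) :* c :* (o :* d) :* β)
              refl (yⁱ i) (yᵒ j) (yᵒ i) (yⁱ j) α β (h (move x i j) - h x) (𝟏ᵒ b)
      ... | true  | true  = solve 7 (λ a b c d α β m →
              con (+ 1) :* con (+ 0) :* m :=
              con (+ 1) :* a :* (con (+ 0) :* b) :* α :+ con (+ 1) :* c :* (con (+ 0) :* d) :* β)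
              refl (yⁱ i) (yᵒ j) (yᵒ i) (yⁱ j) α β (h (move x i j) - h x)

-- The domain of the kernel and the bounds on s.

-- The four blocks must have sizes k, r₂ - k, r₁ - (r₂ - k) and n - r₁ - k; the bounds on `k` say
-- exactly that none of these is negative.
subsets-at-distance : ∀ {n r₁ r₂} k → r₁ ≤ n → r₂ ∸ r₁ ≤ k → k ≤ (n ∸ r₁) ⊓ r₂ →
  ∃₂ λ (x y : Subset n) → ∣ x ∣ ≡ r₁ × ∣ y ∣ ≡ r₂ × ∣ y ─ x ∣ ≡ k
subsets-at-distance {n} {r₁} {r₂} k r₁≤n lower upper =
  let x , y , ex , ey , e = build total in x , y , ≡.trans ex b+c , ≡.trans ey a+b , e
  where
  open ≡.≡-Reasoning
  k≤r₂ = ℕ.≤-trans upper (ℕ.m⊓n≤n (n ∸ r₁) r₂)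
  k≤n∸r₁ = ℕ.≤-trans upper (ℕ.m⊓n≤m (n ∸ r₁) r₂)
  b = r₂ ∸ k
  c = r₁ ∸ b
  d = (n ∸ r₁) ∸ k

  b≤r₁ : b ≤ r₁
  b≤r₁ = ℕ.m≤n+o⇒m∸n≤o r₂ k (≡.subst (r₂ ≤_) (ℕ.+-comm r₁ k)
           (ℕ.≤-trans (ℕ.m≤n+m∸n r₂ r₁) (ℕ.+-monoʳ-≤ r₁ lower)))

  a+b : k ℕ.+ b ≡ r₂
  a+b = ℕ.m+[n∸m]≡n k≤r₂

  b+c : b ℕ.+ c ≡ r₁
  b+c = ℕ.m+[n∸m]≡n b≤r₁

  total : k ℕ.+ (b ℕ.+ (c ℕ.+ d)) ≡ n
  total = begin
    k ℕ.+ (b ℕ.+ (c ℕ.+ d))   ≡⟨ ≡.cong (k ℕ.+_) (ℕ.+-assoc b c d) ⟨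
    k ℕ.+ (b ℕ.+ c ℕ.+ d)     ≡⟨ ≡.cong (λ m → k ℕ.+ (m ℕ.+ d)) b+c ⟩
    k ℕ.+ (r₁ ℕ.+ d)          ≡⟨ ℕ.+-assoc k r₁ d ⟨
    k ℕ.+ r₁ ℕ.+ d            ≡⟨ ≡.cong (ℕ._+ d) (ℕ.+-comm k r₁) ⟩
    r₁ ℕ.+ k ℕ.+ d            ≡⟨ ℕ.+-assoc r₁ k d ⟩
    r₁ ℕ.+ (k ℕ.+ d)          ≡⟨ ≡.cong (r₁ ℕ.+_) (ℕ.m+[n∸m]≡n k≤n∸r₁) ⟩
    r₁ ℕ.+ (n ∸ r₁)           ≡⟨ ℕ.m+[n∸m]≡n r₁≤n ⟩
    n                         ∎

  -- The size is generalised so that the equation `total` can be matched with `≡.refl` in the index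
  -- of `Subset`.
  build : ∀ {n} → k ℕ.+ (b ℕ.+ (c ℕ.+ d)) ≡ n → ∃₂ λ (x y : Subset n) →
          ∣ x ∣ ≡ b ℕ.+ c × ∣ y ∣ ≡ k ℕ.+ b × ∣ y ─ x ∣ ≡ k
  build ≡.refl = subsets-in-position k b c d

module N-bounds {n r₁ r₂ s : ℕ} (s≤N : s ≤ N n r₁ r₂) where

  s≤n∸r₂ : s ≤ n ∸ r₂
  s≤n∸r₂ = ℕ.≤-trans s≤N (ℕ.m⊓n≤n (r₁ ⊓ (n ∸ r₁) ⊓ r₂) _)

  private
    s≤₃ : s ≤ r₁ ⊓ (n ∸ r₁) ⊓ r₂
    s≤₃ = ℕ.≤-trans s≤N (ℕ.m⊓n≤m _ (n ∸ r₂))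

    s≤₂ : s ≤ r₁ ⊓ (n ∸ r₁)
    s≤₂ = ℕ.≤-trans s≤₃ (ℕ.m⊓n≤m _ r₂)

  s≤r₂ : s ≤ r₂
  s≤r₂ = ℕ.≤-trans s≤₃ (ℕ.m⊓n≤n (r₁ ⊓ (n ∸ r₁)) _)

  s≤r₁ : s ≤ r₁
  s≤r₁ = ℕ.≤-trans s≤₂ (ℕ.m⊓n≤m _ (n ∸ r₁))

  s≤n∸r₁ : s ≤ n ∸ r₁
  s≤n∸r₁ = ℕ.≤-trans s≤₂ (ℕ.m⊓n≤n r₁ _)

  s≤n∸s : s ≤ n ∸ s
  s≤n∸s = ℕ.≤-trans s≤n∸r₁ (ℕ.∸-monoʳ-≤ n s≤r₁)

-- From the kernel to the polynomial.

module Main (R : RealNumbers) where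

  open Representation R
  open ComplexField R
  open Newton R
  open Harmonic R
  open Kernel R

  eval-cong : ∀ p {t u} → t ≃ u → eval p t ≃ eval p u
  eval-cong []      t≃u = refl
  eval-cong (c ∷ p) t≃u = +-congˡ (*-cong t≃u (eval-cong p t≃u))

  module _ {n r₁ r₂ s : ℕ} (r₁≤n : r₁ ≤ n) (r₂≤n : r₂ ≤ n) (s≤N : s ≤ N n r₁ r₂)
           (p : Poly) (isλ : Isλ n r₁ r₂ s p) where

    open Isλ isλ
    open N-bounds {n} {r₁} {r₂} s≤N

    private
      m = n ∸ r₁
      Nᶜ = fromℕ n
      X = fromℕ r₁
      Y = fromℕ r₂

    λ-degree : Degree≤ p s
    λ-degree k s<k = mk≃ (proj₂ degree k s<k)

    kernel-equation : ∀ k → r₂ ∸ r₁ ≤ k → k ≤ m ⊓ r₂ →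
      (Y - fromℕ k) * (Nᶜ - X - fromℕ k) * (κ (suc k) - κ k)
        + (X - (Y - fromℕ k)) * fromℕ k * (κ (k ∸ 1) - κ k) + eigenvalue n s * κ k ≃ 0#
    kernel-equation k lower upper with subsets-at-distance {n} {r₁} {r₂} k r₁≤n lower upper
    ... | x , y , ≡.refl , ≡.refl , ≡.refl =
      trans (+-congʳ (sym (moves-kernel x y κ))) (kernel-eigen component₁ intertwiner x y ≡.refl ≡.refl)

    agrees′ : ∀ k → r₂ ∸ r₁ ≤ k → k ≤ m ⊓ r₂ → eval p (fromℕ k) ≃ κ k
    agrees′ k lower upper = mk≃ (agrees k lower upper)

    -- `κ` and the polynomial agree on the domain only. At an end of the domain one neighbour falls
    -- outside, and there its coefficient vanishes: (r₂ - t)(n - r₁ - t) at the upper end, t(r₁ - r₂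
    -- + t) at the lower one.
    hahn-λ : ∀ k → r₂ ∸ r₁ ≤ k → k ≤ m ⊓ r₂ →
      hahn Nᶜ (fromℕ m) Y (eigenvalue n s) (eval p) (fromℕ k) ≃ 0#
    hahn-λ k lower upper =
      trans (+-cong (+-cong forward backward) (*-congˡ (agrees′ k lower upper))) (kernel-equation k lower upper)
      where
      t = fromℕ k

      fromℕ-m : fromℕ m ≃ Nᶜ - X
      fromℕ-m = fromℕ-∸ r₁≤n

      scaled : ∀ {a b u v} → a ≃ b → u ≃ v → a * (u - eval p t) ≃ b * (v - κ k)
      scaled a≃b u≃v = *-cong a≃b (+-cong u≃v (-‿cong (agrees′ k lower upper)))

      both-zero : ∀ {a b u v} → b ≃ 0# → a ≃ b → a * u ≃ b * v
      both-zero b≃0 a≃b = trans (*-congʳ (trans a≃b b≃0)) (trans (zeroˡ _) (sym (trans (*-congʳ b≃0) (zeroˡ _))))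

      forward : (Y - t) * (fromℕ m - t) * (eval p (t + 1#) - eval p t)
              ≃ (Y - t) * (Nᶜ - X - t) * (κ (suc k) - κ k)
      forward with suc k ℕ.≤? m ⊓ r₂
      ... | yes k<min = scaled (*-congˡ (+-congʳ fromℕ-m))
              (trans (eval-cong p (+-comm t 1#)) (agrees′ (suc k) (ℕ.m≤n⇒m≤1+n lower) k<min))
      ... | no k≮min = both-zero boundary (*-congˡ (+-congʳ fromℕ-m))
        where
        k≡min : m ⊓ r₂ ≡ k
        k≡min = ℕ.≤-antisym (ℕ.≮⇒≥ k≮min) upper

        boundary : (Y - t) * (Nᶜ - X - t) ≃ 0#
        boundary with ℕ.⊓-sel m r₂
        ... | inj₁ min≡m  = trans (*-congˡ (trans (+-congʳ (trans (sym fromℕ-m) (reflexive (≡.cong fromℕ (≡.trans (≡.sym min≡m) k≡min)))))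
                              (-‿inverseʳ t))) (zeroʳ _)
        ... | inj₂ min≡r₂ = trans (*-congʳ (trans (+-congʳ (reflexive (≡.cong fromℕ (≡.trans (≡.sym min≡r₂) k≡min)))) (-‿inverseʳ t))) (zeroˡ _)

      coefficient : t * (Nᶜ - fromℕ m - Y + t) ≃ (X - (Y - t)) * t
      coefficient = trans (*-congˡ (+-congʳ (+-congʳ (+-congˡ (-‿cong fromℕ-m)))))
        (solve 4 (λ t n X Y → t :* (n :- (n :- X) :- Y :+ t) := (X :- (Y :- t)) :* t) refl t Nᶜ X Y)

      backward : t * (Nᶜ - fromℕ m - Y + t) * (eval p (t - 1#) - eval p t)
               ≃ (X - (Y - t)) * t * (κ (k ∸ 1) - κ k)
      backward = backward′ k ≡.refl
        where
        backward′ : ∀ k′ → k ≡ k′ → t * (Nᶜ - fromℕ m - Y + t) * (eval p (t - 1#) - eval p t)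
                                  ≃ (X - (Y - t)) * t * (κ (k′ ∸ 1) - κ k)
        backward′ zero     ≡.refl = both-zero (zeroʳ _) coefficient
        backward′ (suc k′) ≡.refl with r₂ ∸ r₁ ℕ.≤? k′
        ... | yes lower′ = scaled coefficient (trans
                (eval-cong p (solve 1 (λ a → con (+ 1) :+ a :- con (+ 1) := a) refl (fromℕ k′)))
                (agrees′ k′ lower′ (ℕ.<⇒≤ upper)))
        ... | no ¬lower′ = both-zero boundary coefficient
          where
          k≡ : r₂ ∸ r₁ ≡ suc k′
          k≡ = ℕ.≤-antisym lower (ℕ.≰⇒> ¬lower′)

          -- The truncated difference is positive here, hence a true one, and r₁ - r₂ + t is zero.
          r₁≤r₂ : r₁ ≤ r₂
          r₁≤r₂ = ℕ.<⇒≤ (ℕ.m∸n≢0⇒n<m {r₂} {r₁} λ eq → ℕ.1+n≢0 (≡.trans (≡.sym k≡) eq))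

          boundary : (X - (Y - t)) * t ≃ 0#
          boundary = trans (*-congʳ (trans
            (+-congˡ (-‿cong (+-congˡ (-‿cong (trans (reflexive (≡.cong fromℕ (≡.sym k≡))) (fromℕ-∸ r₁≤r₂))))))
            (solve 2 (λ X Y → X :- (Y :- (Y :- X)) := con (+ 0)) refl X Y))) (zeroˡ t)

    -- The upper end min(n - r₁, r₂) exceeds the lower end max(0, r₂ - r₁) by exactly `N n r₁ r₂`,
    -- which leaves room for the `s` zeros wanted by `newton-zeros`.
    in-domain : ∀ i → i < s → (r₂ ∸ r₁) ℕ.+ i ≤ m ⊓ r₂
    in-domain i i<s = ℕ.⊓-glb bound₁ bound₂
      where
      i≤ : ∀ {k} → s ≤ k → i ≤ k
      i≤ = ℕ.≤-trans (ℕ.<⇒≤ i<s)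

      bound₁ : (r₂ ∸ r₁) ℕ.+ i ≤ m
      bound₁ with ℕ.≤-total r₁ r₂
      ... | inj₂ r₂≤r₁ = ≡.subst (λ d → d ℕ.+ i ≤ m) (≡.sym (ℕ.m≤n⇒m∸n≡0 r₂≤r₁)) (i≤ s≤n∸r₁)
      ... | inj₁ r₁≤r₂ = ≡.subst (_≤ m) (ℕ.+-∸-comm i r₁≤r₂)
              (ℕ.∸-monoˡ-≤ r₁ (≡.subst (r₂ ℕ.+ i ≤_) (ℕ.m+[n∸m]≡n r₂≤n) (ℕ.+-monoʳ-≤ r₂ (i≤ s≤n∸r₂))))

      bound₂ : (r₂ ∸ r₁) ℕ.+ i ≤ r₂
      bound₂ with ℕ.≤-total r₁ r₂
      ... | inj₂ r₂≤r₁ = ≡.subst (λ d → d ℕ.+ i ≤ r₂) (≡.sym (ℕ.m≤n⇒m∸n≡0 r₂≤r₁)) (i≤ s≤r₂)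
      ... | inj₁ r₁≤r₂ = ≡.subst ((r₂ ∸ r₁) ℕ.+ i ≤_) (ℕ.m∸n+n≡m r₁≤r₂) (ℕ.+-monoʳ-≤ (r₂ ∸ r₁) (i≤ s≤r₁))

    λ-recurrence : Recurrence n m r₂ s (coeffⁿ p)
    λ-recurrence = hahn-zeros⇒recurrence n m r₂ s p (r₂ ∸ r₁) λ-degree λ i i<s →
      hahn-λ _ (ℕ.m≤m+n (r₂ ∸ r₁) i) (in-domain i i<s)

    λ-initial : coeffⁿ p 0 ≃ 1#
    λ-initial = trans (coeffⁿ-0 p) (mk≃ normalised)

    open ClosedForm {n} {m} {r₂} {s} s≤r₂ s≤n∸r₁ s≤n∸s (coeffⁿ p) λ-initial λ-recurrence

    λ-formula : ∀ t → eval p t ≃ sum {suc s} (λ i → let j = toℕ i in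
      (- 1#) ^ j * binom t j * (fromℕ ((s P j) ℕ.* ((n ∸ s ℕ.+ 1) P j)) / (((n ∸ r₁) P j) ℕ.* (r₂ P j))))
    λ-formula t = trans (eval-newton p s λ-degree t) (sym (expansion t))

    λ-leading : coeff p s ≃ (- 1#) ^ s * (fromℕ ((n ∸ s ℕ.+ 1) P s) / (((n ∸ r₁) P s) ℕ.* (r₂ P s)))
    λ-leading = trans (sym (coeffⁿ-leading p s λ-degree)) leading

  -- For `1 ≤ s` the bound by `N` forces n ≥ 2 and r₁, r₂ ≥ 1, so the truncated subtractions in the
  -- parameters of `q` are true ones. The helper `go` takes these facts as arguments in order to
  -- match on successors.
  λ-difference : ∀ {n r₁ r₂ s} → r₁ ≤ n → r₂ ≤ n → s ≤ N n r₁ r₂ → 1 ≤ s →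
    ∀ p → Isλ n r₁ r₂ s p → ∀ q → Isλ (n ∸ 2) (r₁ ∸ 1) (r₂ ∸ 1) (s ∸ 1) q →
    ∀ t → Δ (eval p) t ≃ - (fromℕ (s ℕ.* (n ∸ s ℕ.+ 1)) / (r₂ ℕ.* (n ∸ r₁))) * eval q t
  λ-difference {n} {r₁} {r₂} {s} r₁≤n r₂≤n s≤N 1≤s p isλp q isλq t =
    go 2≤n (ℕ.≤-trans 1≤s s≤r₁) (ℕ.≤-trans 1≤s s≤r₂) 1≤s r₁≤n r₂≤n s≤N isλp isλq
    where
    open N-bounds {n} {r₁} {r₂} s≤N

    2≤n : 2 ≤ n
    2≤n = ≡.subst (2 ≤_) (ℕ.m+[n∸m]≡n r₁≤n) (ℕ.+-mono-≤ (ℕ.≤-trans 1≤s s≤r₁) (ℕ.≤-trans 1≤s s≤n∸r₁))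

    go : ∀ {n r₁ r₂ s} → 2 ≤ n → 1 ≤ r₁ → 1 ≤ r₂ → 1 ≤ s → r₁ ≤ n → r₂ ≤ n → s ≤ N n r₁ r₂ →
         Isλ n r₁ r₂ s p → Isλ (n ∸ 2) (r₁ ∸ 1) (r₂ ∸ 1) (s ∸ 1) q →
         Δ (eval p) t ≃ - (fromℕ (s ℕ.* (n ∸ s ℕ.+ 1)) / (r₂ ℕ.* (n ∸ r₁))) * eval q t
    go {suc (suc n)} {suc r₁} {suc r₂} {suc s} (s≤s (s≤s _)) (s≤s _) (s≤s _) (s≤s _) r₁≤n r₂≤n s≤N isλp isλq = begin
      eval p (t + 1#) - eval p t
        ≈⟨ +-cong (eval-newton p (suc s) (λ-degree r₁≤n r₂≤n s≤N p isλp) (t + 1#))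
                  (-‿cong (eval-newton p (suc s) (λ-degree r₁≤n r₂≤n s≤N p isλp) t)) ⟩
      newton a (suc (suc s)) (t + 1#) - newton a (suc (suc s)) t
        ≈⟨ Δ-newton a (suc s) t ⟩
      newton (shift a) (suc s) t
        ≈⟨ newton-cong (suc s) t (λ { j (s≤s j≤s) → shift-recurrence (ℕ.s≤s⁻¹ Bounds.s≤r₂) s≤n∸r₁′ s≤n a b
             (λ-initial r₁≤n r₂≤n s≤N p isλp) (λ-initial r₁≤n′ r₂≤n′ s≤N′ q isλq)
             recᵃ (λ-recurrence r₁≤n′ r₂≤n′ s≤N′ q isλq) j j≤s }) ⟩
      newton (λ j → - Q (suc (n ∸ r₁)) * b j) (suc s) t
        ≈⟨ newton-scale (- Q (suc (n ∸ r₁))) b (suc s) t ⟩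
      - Q (suc (n ∸ r₁)) * newton b (suc s) t
        ≈⟨ *-congˡ (eval-newton q s (λ-degree r₁≤n′ r₂≤n′ s≤N′ q isλq) t) ⟨
      - Q (suc (n ∸ r₁)) * eval q t
        ≡⟨ ≡.cong (λ m → - Q m * eval q t) (ℕ.+-∸-assoc 1 r₁≤n′) ⟨
      - Q (suc n ∸ r₁) * eval q t ∎
      where
      module Bounds = N-bounds {suc (suc n)} {suc r₁} {suc r₂} s≤N
      a = coeffⁿ p
      b = coeffⁿ q

      Q : ℕ → ℂ
      Q m = fromℕ (suc s ℕ.* (suc n ∸ s ℕ.+ 1)) / (suc r₂ ℕ.* m)

      below : ∀ {r} → suc s ≤ suc n ∸ r → r ≤ n
      below {r} s< = ℕ.s≤s⁻¹ (ℕ.m∸n≢0⇒n<m {suc n} {r} λ eq → contradiction (≡.subst (suc s ≤_) eq s<) λ ())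

      r₁≤n′ = below {r₁} Bounds.s≤n∸r₁
      r₂≤n′ = below {r₂} Bounds.s≤n∸r₂

      drop : ∀ {r} → r ≤ n → suc s ≤ suc n ∸ r → s ≤ n ∸ r
      drop r≤n s< = ℕ.s≤s⁻¹ (≡.subst (suc s ≤_) (ℕ.+-∸-assoc 1 r≤n) s<)

      s≤n∸r₁′ = drop r₁≤n′ Bounds.s≤n∸r₁

      s≤n : s ≤ n
      s≤n = ℕ.≤-trans s≤n∸r₁′ (ℕ.m∸n≤m n r₁)

      -- Each of the four entries of the minimum drops by exactly one, just as `s` does.
      s≤N′ : s ≤ N n r₁ r₂
      s≤N′ = ℕ.⊓-glb (ℕ.⊓-glb (ℕ.⊓-glb (ℕ.s≤s⁻¹ Bounds.s≤r₁) s≤n∸r₁′) (ℕ.s≤s⁻¹ Bounds.s≤r₂)) (drop r₂≤n′ Bounds.s≤n∸r₂)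

      recᵃ : Recurrence (suc (suc n)) (suc (n ∸ r₁)) (suc r₂) (suc s) a
      recᵃ = ≡.subst (λ m → Recurrence (suc (suc n)) m (suc r₂) (suc s) a) (ℕ.+-∸-assoc 1 r₁≤n′)
        (λ-recurrence r₁≤n r₂≤n s≤N p isλp)

theorem3 : (R : RealNumbers) → let open Representation R in
    (n r₁ r₂ s : ℕ) → 1 ≤ n → r₁ ≤ n → r₂ ≤ n → s ≤ N n r₁ r₂ →
    (p : Poly) → Isλ n r₁ r₂ s p →
    (∀ t → eval p t ≈ sum {ℕ.suc s} (λ i → let j = toℕ i in
      (- 1#) ^ j * binom t j * (fromℕ ((s P j) ℕ.* ((n ∸ s ℕ.+ 1) P j)) / (((n ∸ r₁) P j) ℕ.* (r₂ P j)))))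
    × (1 ≤ s → (q : Poly) → Isλ (n ∸ 2) (r₁ ∸ 1) (r₂ ∸ 1) (s ∸ 1) q →
      ∀ t → Δ (eval p) t ≈ - (fromℕ (s ℕ.* (n ∸ s ℕ.+ 1)) / (r₂ ℕ.* (n ∸ r₁))) * eval q t)
    × (coeff p s ≈ (- 1#) ^ s * (fromℕ ((n ∸ s ℕ.+ 1) P s) / (((n ∸ r₁) P s) ℕ.* (r₂ P s))))
theorem3 R n r₁ r₂ s _ r₁≤n r₂≤n s≤N p isλ =
    (λ t → ≃⇒≈ (λ-formula r₁≤n r₂≤n s≤N p isλ t))
  , (λ 1≤s q isλ′ t → ≃⇒≈ (λ-difference r₁≤n r₂≤n s≤N 1≤s p isλ q isλ′ t))
  , ≃⇒≈ (λ-leading r₁≤n r₂≤n s≤N p isλ)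
  where
  open ComplexField R
  open Main R
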